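{- For every $n\in\mathbb{N}$, the polynomial $(-q;q)_n=\prod_{0<k\le n}(1+q^k)$ divides $S_{2n}(q)$ in the ring $\mathbb{Z}[q]$.
   Context: For $n\in\mathbb{N}$, $(a;q)_n=\prod_{0\le k<n}(1-aq^k)$ (with $(a;q)_0=1$). The $q$-Sali\'e numbers $S_n(q)$ ($n\in\mathbb{N}$) are defined by the formal power series identity $$\sum_{n=0}^\infty S_{n}(q)\frac{x^{n}}{(q;q)_{n}}=\sum_{n=0}^\infty \frac{q^{n(n-1)}x^{2n}}{(q;q)_{2n}}\Big/\sum_{n=0}^\infty \frac{(-1)^nq^{\binom{2n}{2}}x^{2n}}{(q;q)_{2n}};$$ they are polynomials in $q$ with integer coefficients. -}

module Defs where

open import Data.Nat using (ℕ; zero; suc; _*_; _∸_)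
open import Data.Integer using (ℤ; 0ℤ; 1ℤ; -_) renaming (_+_ to _+ℤ_; _*_ to _*ℤ_)
open import Data.List using (List; []; _∷_; map; replicate; _++_)
open import Data.Maybe using (Maybe; just; nothing)
open import Data.Product using (Σ)
open import Relation.Binary.PropositionalEquality using (_≡_)

-- Polynomials in ℤ[q] as coefficient lists, lowest degree first.
-- Trailing zeros are allowed; equality is coefficientwise (_≈P_).
Poly : Set
Poly = List ℤ

coeff : Poly → ℕ → ℤ
coeff []      _       = 0ℤ
coeff (a ∷ p) zero    = a
coeff (a ∷ p) (suc i) = coeff p i

_≈P_ : Poly → Poly → Set
p ≈P r = ∀ i → coeff p i ≡ coeff r i

infixl 6 _+P_ _-P_
infixl 7 _*P_

_+P_ : Poly → Poly → Poly
[]      +P r       = r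
(a ∷ p) +P []      = a ∷ p
(a ∷ p) +P (b ∷ r) = (a +ℤ b) ∷ (p +P r)

negP : Poly → Poly
negP = map -_

_-P_ : Poly → Poly → Poly
p -P r = p +P negP r

_*P_ : Poly → Poly → Poly
[]      *P r = []
(a ∷ p) *P r = map (a *ℤ_) r +P (0ℤ ∷ (p *P r))

oneP : Poly
oneP = 1ℤ ∷ []

qPow : ℕ → Poly
qPow k = replicate k 0ℤ ++ (1ℤ ∷ [])

_∣P_ : Poly → Poly → Set
p ∣P r = Σ Poly (λ s → (p *P s) ≈P r)

negqPoch : ℕ → Poly
negqPoch zero    = oneP
negqPoch (suc n) = negqPoch n *P (oneP +P qPow (suc n))

-- Gaussian binomial coefficient [n choose k]_q = (q;q)_n / ((q;q)_k (q;q)_{n-k}),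
-- via q-Pascal: [n+1,k+1] = [n,k] + q^{k+1} [n,k+1].
qbin : ℕ → ℕ → Poly
qbin n       zero    = oneP
qbin zero    (suc k) = []
qbin (suc n) (suc k) = qbin n k +P (qPow (suc k) *P qbin n (suc k))

half : ℕ → Maybe ℕ
half zero          = just zero
half (suc zero)    = nothing
half (suc (suc m)) with half m
... | just j  = just (suc j)
... | nothing = nothing

sgn : ℕ → ℤ
sgn zero    = 1ℤ
sgn (suc k) = - sgn k

-- (q;q)_m * [x^m] of the numerator series  Σ q^{n(n-1)} x^{2n}/(q;q)_{2n}
numC : ℕ → Poly
numC m with half m
... | just j  = qPow (j * (j ∸ 1))
... | nothing = []

-- (q;q)_r * [x^r] of the denominator series  Σ (-1)^n q^{C(2n,2)} x^{2n}/(q;q)_{2n}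
-- (C(2n,2) = n(2n-1))
denC : ℕ → Poly
denC r with half r
... | just k  = (sgn k ∷ []) *P qPow (k * (2 * k ∸ 1))
... | nothing = []

-- Comparing coefficients of x^m/(q;q)_m in  (Σ S_n x^n/(q;q)_n) · den = num
-- (denC 0 = 1) gives  S_m = numC m - Σ_{r=1}^{m} [m choose r]_q · denC r · S_{m-r}.
-- salieTable m = S_m ∷ S_{m-1} ∷ … ∷ S_0.
salieTable : ℕ → List Poly
salieTable zero    = numC zero ∷ []
salieTable (suc m) = (numC (suc m) -P go 0 (salieTable m)) ∷ salieTable m
  where
  -- the list element at index i is S_{m-i} = S_{(m+1)-r} with r = i+1
  go : ℕ → List Poly → Poly
  go i []       = []
  go i (s ∷ ss) = (qbin (suc m) (suc i) *P denC (suc i)) *P s +P go (suc i) ss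

salie : ℕ → Poly
salie m with salieTable m
... | s ∷ _ = s
... | []    = []

{-# OPTIONS --safe #-}
module Submission where

-- Write Gₙ = (-q;q)ₙ and cos = Σ (-1)ⁿ x²ⁿ/(q;q)₂ₙ. Multiplying den · S = num, the definition of the
-- q-Salié numbers, by cos gives (cos · den) · S = cos · num. By induction on n it then suffices that Gₙ
-- divides the n-th coefficients (with respect to x²ⁿ/(q;q)₂ₙ) of cos · den and of cos · num, and that
-- G_{k+l} divides [2k+2l choose 2k] Gₖ Gₗ.
-- The coefficients of cos · den are products, by the q-binomial theorem. Up to a power of q, that of
-- cos · num is the case a = 1, b = n of
--   Σ_{k+l=n} (-1)ᵏ [2n choose 2k] q^(k(k-1)/2 + l(l-1)/2 + ak + bl),   a + b + n odd.
-- These sums and their variants with odd indices are related by the two Pascal rules and by the reversal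
-- k ↔ l. Modulo Gₙ the relations determine all sums of a given n from one of them, which is equal to its
-- own negative or visibly gains the factor 1 + qⁿ. Since Gₙ has constant term 1, it divides x as soon as
-- it divides 2x or qx.

-- Induction on den · S = num itself cannot work: up to sign the coefficients of den and num are
-- powers of q, which Gₙ does not divide for n > 0. Multiplying by cos repairs both sides at once
-- and keeps the constant coefficient 1, so the n-th coefficient of S can still be isolated.
--
-- Pascal's rule changes the parity of an index, so sums over even indices alone are not closed
-- under it and all parity classes are carried along. Each level gains one factor: knowledge of the
-- even-odd sums of size m modulo Gₘ yields the even-even sums of size m + 1 and the odd-odd sums of
-- size m modulo Gₘ₊₁. The new factor 1 + q^(m+1) appears because expansions by the two Pascal rules
-- differ by a shift worth q^(2m+2), which leaves 1 - q^(2m+2).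
--
-- The condition a + b + n odd survives reversal and simultaneous shifts of a and b; at a = b = 0 it
-- makes n odd, which is when reversal changes the sign.
--
-- Apart from the two cancellations, of 2 and of q, everything is a chain of identities valid in any
-- commutative ring; no factorization into irreducibles enters.

open import Defs
open import Algebra.Bundles using (CommutativeRing)
open import Algebra.Solver.Ring.AlmostCommutativeRing
  using (fromCommutativeRing; _-Raw-AlmostCommutative⟶_)
open import Data.Empty using (⊥)
import Data.Fin as Fin
open import Data.Integer as ℤ using (ℤ; 0ℤ; 1ℤ; +-*-rawRing)
import Data.Integer.Properties as ℤ
import Data.Integer.Tactic.RingSolver as ℤ-Solver
open import Data.List using (List; []; _∷_; map; drop)
open import Data.Maybe using (Maybe; just; nothing)
open import Data.Nat as ℕ using (ℕ; zero; suc)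
open import Data.Nat.Induction using (<-rec)
import Data.Nat.Properties as ℕ
import Data.Nat.Tactic.RingSolver as ℕ-Solver
open import Data.Product using (∃; _,_)
open import Data.Unit using (⊤)
open import Level using (0ℓ)
import Relation.Binary.PropositionalEquality as ≡
open ≡ using (_≡_; module ≡-Reasoning)
open import Relation.Nullary using (yes; no)

-- The homomorphism fromℤ only supplies the coefficients of the ring solver.
module GaussianSums
  {c ℓ} (R : CommutativeRing c ℓ)
  (fromℤ : +-*-rawRing -Raw-AlmostCommutative⟶ fromCommutativeRing R)
  (q : CommutativeRing.Carrier R) where

  open CommutativeRing R hiding (zero)
  open import Algebra.Properties.Semiring.Exp semiring using (_^_; ^-homo-*; ^-assocʳ; ^-congʳ)
  open import Algebra.Properties.Semiring.Divisibility semiring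
    using (_∣_; _,_; _∣0; ∣ʳ-respʳ-≈; x∣ʳy⇒x∣ʳzy; x∣ʳy⇒xz∣ʳyz)
  open import Relation.Binary.Reasoning.Setoid setoid

  private
    module ℤ⟶ = _-Raw-AlmostCommutative⟶_ fromℤ

    _coeff≟_ : ∀ a b → Maybe (ℤ⟶.⟦ a ⟧ ≈ ℤ⟶.⟦ b ⟧)
    a coeff≟ b with a ℤ.≟ b
    ... | yes ≡.refl = just refl
    ... | no  _      = nothing

  open import Algebra.Solver.Ring +-*-rawRing (fromCommutativeRing R) fromℤ _coeff≟_
    using (Polynomial; solve; var; _:=_; _:+_; _:*_; _:-_; :-_; _:^_)

  -- The constant 1 as x⁰: it evaluates to 1# itself and not to the image of 1ℤ.
  :1 : ∀ {n} → Polynomial (suc n)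
  :1 = var Fin.zero :^ 0

  -- Sums over pairs of indices with a given total

  -- Σ₊ n F = Σ_{k+l=n} F k l
  Σ₊ : ℕ → (ℕ → ℕ → Carrier) → Carrier
  Σ₊ zero    F = F 0 0
  Σ₊ (suc n) F = F 0 (suc n) + Σ₊ n λ k l → F (suc k) l

  Σ₊-cong : ∀ n {F G : ℕ → ℕ → Carrier} → (∀ k l → F k l ≈ G k l) → Σ₊ n F ≈ Σ₊ n G
  Σ₊-cong zero    F≈G = F≈G 0 0
  Σ₊-cong (suc n) F≈G = +-cong (F≈G 0 (suc n)) (Σ₊-cong n λ k l → F≈G (suc k) l)

  Σ₊-cong-on : ∀ n {F G : ℕ → ℕ → Carrier} →
               (∀ k l → k ℕ.+ l ≡ n → F k l ≈ G k l) → Σ₊ n F ≈ Σ₊ n G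
  Σ₊-cong-on zero    F≈G = F≈G 0 0 ≡.refl
  Σ₊-cong-on (suc n) F≈G =
    +-cong (F≈G 0 (suc n) ≡.refl) (Σ₊-cong-on n λ k l k+l≡n → F≈G (suc k) l (≡.cong suc k+l≡n))

  +-interchange : ∀ a b c d → (a + b) + (c + d) ≈ (a + c) + (b + d)
  +-interchange = solve 4 (λ a b c d → (a :+ b) :+ (c :+ d) := (a :+ c) :+ (b :+ d)) refl

  Σ₊-+ : ∀ n F G → Σ₊ n (λ k l → F k l + G k l) ≈ Σ₊ n F + Σ₊ n G
  Σ₊-+ zero    F G = refl
  Σ₊-+ (suc n) F G =
    trans (+-congˡ (Σ₊-+ n (λ k l → F (suc k) l) (λ k l → G (suc k) l))) (+-interchange _ _ _ _)

  Σ₊-*ˡ : ∀ n x F → Σ₊ n (λ k l → x * F k l) ≈ x * Σ₊ n F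
  Σ₊-*ˡ zero    x F = refl
  Σ₊-*ˡ (suc n) x F = trans (+-congˡ (Σ₊-*ˡ n x (λ k l → F (suc k) l))) (sym (distribˡ x _ _))

  Σ₊-last : ∀ n F → Σ₊ (suc n) F ≈ Σ₊ n (λ k l → F k (suc l)) + F (suc n) 0
  Σ₊-last zero    F = refl
  Σ₊-last (suc n) F = trans (+-congˡ (Σ₊-last n (λ k l → F (suc k) l))) (sym (+-assoc _ _ _))

  Σ₊-swap : ∀ n F → Σ₊ n F ≈ Σ₊ n λ k l → F l k
  Σ₊-swap zero    F = refl
  Σ₊-swap (suc n) F = begin
    F 0 (suc n) + Σ₊ n (λ k l → F (suc k) l)  ≈⟨ +-congˡ (Σ₊-swap n (λ k l → F (suc k) l)) ⟩
    F 0 (suc n) + Σ₊ n (λ k l → F (suc l) k)  ≈⟨ +-comm _ _ ⟩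
    Σ₊ n (λ k l → F (suc l) k) + F 0 (suc n)  ≈⟨ Σ₊-last n (λ k l → F l k) ⟨
    Σ₊ (suc n) (λ k l → F l k)                ∎

  Σ₊-assoc : ∀ n (F : ℕ → ℕ → ℕ → Carrier) →
             Σ₊ n (λ k m → Σ₊ k λ i j → F i j m) ≈ Σ₊ n (λ i k → Σ₊ k λ j m → F i j m)
  Σ₊-assoc zero    F = refl
  Σ₊-assoc (suc n) F = begin
    F 0 0 (suc n) + Σ₊ n (λ k m → F 0 (suc k) m + Σ₊ k λ i j → F (suc i) j m)
      ≈⟨ +-congˡ (Σ₊-+ n (λ k m → F 0 (suc k) m) _) ⟩
    F 0 0 (suc n) + (Σ₊ n (λ k m → F 0 (suc k) m) + Σ₊ n (λ k m → Σ₊ k λ i j → F (suc i) j m))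
      ≈⟨ +-assoc _ _ _ ⟨
    Σ₊ (suc n) (λ j m → F 0 j m) + Σ₊ n (λ k m → Σ₊ k λ i j → F (suc i) j m)
      ≈⟨ +-congˡ (Σ₊-assoc n λ i → F (suc i)) ⟩
    Σ₊ (suc n) (λ j m → F 0 j m) + Σ₊ n (λ i k → Σ₊ k λ j m → F (suc i) j m)
      ∎

  private
    -- The form that `Σ₊-split` takes once its first summand is removed: `F` and `F₁` are shifted in
    -- the left index, so only the right end of the range remains exceptional and the induction
    -- closes.
    Σ₊-split′ : ∀ n (F F₁ F₂ : ℕ → ℕ → Carrier) →
                (∀ k → F k 0 ≈ F₂ k 0) →
                (∀ k l → F k (suc l) ≈ F₁ k l + F₂ k (suc l)) →
                Σ₊ (suc n) F ≈ Σ₊ n F₁ + Σ₊ (suc n) F₂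
    Σ₊-split′ zero    F F₁ F₂ r m = trans (+-cong (m 0 0) (r 1)) (+-assoc _ _ _)
    Σ₊-split′ (suc n) F F₁ F₂ r m =
      trans (+-cong (m 0 (suc n))
                    (Σ₊-split′ n (λ k → F (suc k)) (λ k → F₁ (suc k)) (λ k → F₂ (suc k))
                               (λ k → r (suc k)) (λ k → m (suc k))))
            (+-interchange _ _ _ _)

  -- The pattern of Pascal's rule under a sum: an interior summand splits into one with lowered
  -- right index and one with lowered left index, while each end of the range has only one of the
  -- two.
  Σ₊-split : ∀ n (F F₁ F₂ : ℕ → ℕ → Carrier) →
             (∀ l → F 0 (suc l) ≈ F₁ 0 l) →
             (∀ k → F (suc k) 0 ≈ F₂ k 0) →
             (∀ k l → F (suc k) (suc l) ≈ F₁ (suc k) l + F₂ k (suc l)) →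
             Σ₊ (suc n) F ≈ Σ₊ n F₁ + Σ₊ n F₂
  Σ₊-split zero    F F₁ F₂ l r m = +-cong (l 0) (r 0)
  Σ₊-split (suc n) F F₁ F₂ l r m =
    trans (+-cong (l (suc n)) (Σ₊-split′ n (λ k → F (suc k)) (λ k → F₁ (suc k)) F₂ r m))
          (sym (+-assoc _ _ _))

  -- Doubling, and divisibility of sums

  dbl : ℕ → ℕ
  dbl zero    = zero
  dbl (suc k) = suc (suc (dbl k))

  dbl≡2* : ∀ k → dbl k ≡ 2 ℕ.* k
  dbl≡2* zero    = ≡.refl
  dbl≡2* (suc k) = ≡.cong suc (≡.trans (≡.cong suc (dbl≡2* k)) (≡.sym (ℕ.+-suc k (k ℕ.+ 0))))

  dbl-+ : ∀ k l → dbl (k ℕ.+ l) ≡ dbl k ℕ.+ dbl l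
  dbl-+ zero    l = ≡.refl
  dbl-+ (suc k) l = ≡.cong (λ n → suc (suc n)) (dbl-+ k l)

  Σ₊-even : ∀ n F → (∀ k l → F (suc (dbl k)) l ≈ 0#) →
            Σ₊ (dbl n) F ≈ Σ₊ n λ k l → F (dbl k) (dbl l)
  Σ₊-even zero    F odd = refl
  Σ₊-even (suc n) F odd = +-congˡ (begin
    F 1 (suc (dbl n)) + Σ₊ (dbl n) (λ k l → F (suc (suc k)) l)
      ≈⟨ +-cong (odd 0 _) (Σ₊-even n (λ k l → F (suc (suc k)) l) λ k → odd (suc k)) ⟩
    0# + Σ₊ n (λ k l → F (dbl (suc k)) (dbl l))
      ≈⟨ +-identityˡ _ ⟩
    Σ₊ n (λ k l → F (dbl (suc k)) (dbl l))
      ∎)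

  ∣-+ : ∀ {d x y} → d ∣ x → d ∣ y → d ∣ x + y
  ∣-+ (u , ud≈x) (v , vd≈y) = u + v , trans (distribʳ _ u v) (+-cong ud≈x vd≈y)

  ∣-*ʳ : ∀ {d x} y → d ∣ x → d ∣ x * y
  ∣-*ʳ y d∣x = ∣ʳ-respʳ-≈ (*-comm y _) (x∣ʳy⇒x∣ʳzy y d∣x)

  ∣-neg : ∀ {d x} → d ∣ x → d ∣ - x
  ∣-neg {d} (u , ud≈x) = - u , trans (solve 2 (λ u d → (:- u) :* d := :- (u :* d)) refl u d) (-‿cong ud≈x)

  ∣-Σ₊ : ∀ {d} n {F} → (∀ k l → k ℕ.+ l ≡ n → d ∣ F k l) → d ∣ Σ₊ n F
  ∣-Σ₊ zero    d∣F = d∣F 0 0 ≡.refl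
  ∣-Σ₊ (suc n) d∣F = ∣-+ (d∣F 0 (suc n) ≡.refl) (∣-Σ₊ n λ k l k+l≡n → d∣F (suc k) l (≡.cong suc k+l≡n))

  -- Gaussian binomial coefficients

  -- binom i j is the Gaussian binomial coefficient [i+j choose i].
  binom : ℕ → ℕ → Carrier
  binom zero    j       = 1#
  binom (suc i) zero    = 1#
  binom (suc i) (suc j) = binom i (suc j) + q ^ suc i * binom (suc i) j

  binom-0 : ∀ i → binom i 0 ≈ 1#
  binom-0 zero    = refl
  binom-0 (suc i) = refl

  mutual
    -- Both absorption rules have the same right-hand side, so together they exchange the two
    -- neighbours that Pascal's rule adds up. Each inductive step needs this exchange, hence the
    -- mutual proof. The product form replaces quotients, which a general ring does not have.
    absorbˡ : ∀ i j → (1# - q ^ suc i) * binom (suc i) j ≈ (1# - q ^ suc (i ℕ.+ j)) * binom i j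
    absorbˡ i zero rewrite ℕ.+-identityʳ i = *-congˡ (sym (binom-0 i))
    absorbˡ i (suc j) = begin
      (1# - u) * (b + u * b₁)
        ≈⟨ solve 3 (λ u b b₁ → (:1 :- u) :* (b :+ u :* b₁) := (:1 :- u) :* b :+ u :* ((:1 :- u) :* b₁)) refl u b b₁ ⟩
      (1# - u) * b + u * ((1# - u) * b₁)
        ≈⟨ +-congˡ (*-congˡ (trans (absorbˡ i j) (sym (absorbʳ i j)))) ⟩
      (1# - u) * b + u * ((1# - v) * b)
        ≈⟨ solve 3 (λ u v b → (:1 :- u) :* b :+ u :* ((:1 :- v) :* b) := (:1 :- u :* v) :* b) refl u v b ⟩
      (1# - u * v) * b
        ≈⟨ *-congʳ (+-congˡ (-‿cong (^-homo-* q (suc i) (suc j)))) ⟨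
      (1# - q ^ suc (i ℕ.+ suc j)) * b
        ∎
      where u = q ^ suc i; v = q ^ suc j; b = binom i (suc j); b₁ = binom (suc i) j

    absorbʳ : ∀ i j → (1# - q ^ suc j) * binom i (suc j) ≈ (1# - q ^ suc (i ℕ.+ j)) * binom i j
    absorbʳ zero    j = refl
    absorbʳ (suc i) j = begin
      (1# - v) * (b + u * b₁)
        ≈⟨ solve 4 (λ u v b b₁ → (:1 :- v) :* (b :+ u :* b₁) := (:1 :- v) :* b :+ u :* ((:1 :- v) :* b₁)) refl u v b b₁ ⟩
      (1# - v) * b + u * ((1# - v) * b₁)
        ≈⟨ +-congʳ (trans (absorbʳ i j) (sym (absorbˡ i j))) ⟩
      (1# - u) * b₁ + u * ((1# - v) * b₁)
        ≈⟨ solve 3 (λ u v b → (:1 :- u) :* b :+ u :* ((:1 :- v) :* b) := (:1 :- u :* v) :* b) refl u v b₁ ⟩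
      (1# - u * v) * b₁
        ≈⟨ *-congʳ (+-congˡ (-‿cong (trans (^-congʳ q (≡.cong suc (≡.sym (ℕ.+-suc i j)))) (^-homo-* q (suc i) (suc j))))) ⟨
      (1# - q ^ suc (suc i ℕ.+ j)) * b₁
        ∎
      where u = q ^ suc i; v = q ^ suc j; b = binom i (suc j); b₁ = binom (suc i) j

  -- The two Pascal rules differ by `(1# - v) * b - (1# - u) * b₁`, which vanishes by absorption.
  pascal′ : ∀ i j → binom (suc i) (suc j) ≈ q ^ suc j * binom i (suc j) + binom (suc i) j
  pascal′ i j = begin
    b + u * b₁
      ≈⟨ solve 4 (λ u v b b₁ → b :+ u :* b₁ := ((:1 :- v) :* b :+ u :* b₁) :+ v :* b) refl u v b b₁ ⟩
    ((1# - v) * b + u * b₁) + v * b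
      ≈⟨ +-congʳ (+-congʳ (trans (absorbʳ i j) (sym (absorbˡ i j)))) ⟩
    ((1# - u) * b₁ + u * b₁) + v * b
      ≈⟨ solve 4 (λ u v b b₁ → ((:1 :- u) :* b₁ :+ u :* b₁) :+ v :* b := v :* b :+ b₁) refl u v b b₁ ⟩
    v * b + b₁
      ∎
    where u = q ^ suc i; v = q ^ suc j; b = binom i (suc j); b₁ = binom (suc i) j

  binom-sym : ∀ i j → binom i j ≈ binom j i
  binom-sym zero    j       = sym (binom-0 j)
  binom-sym (suc i) zero    = refl
  binom-sym (suc i) (suc j) = begin
    binom i (suc j) + q ^ suc i * binom (suc i) j  ≈⟨ +-cong (binom-sym i (suc j)) (*-congˡ (binom-sym (suc i) j)) ⟩
    binom (suc j) i + q ^ suc i * binom j (suc i)  ≈⟨ +-comm _ _ ⟩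
    q ^ suc i * binom j (suc i) + binom (suc j) i  ≈⟨ pascal′ j i ⟨
    binom (suc j) (suc i)                          ∎

  binom-congˡ : ∀ {i i′} j → i ≡ i′ → binom i j ≈ binom i′ j
  binom-congˡ j ≡.refl = refl

  binom-congʳ : ∀ i {j j′} → j ≡ j′ → binom i j ≈ binom i j′
  binom-congʳ i ≡.refl = refl

  -- Both sides are the q-multinomial coefficient with parts i, j, k. It has a Pascal rule with
  -- three terms, one for each lowered part, and the induction matches these terms. Associativity of
  -- `_⋆_` rests on it.
  trinomial : ∀ i j k → binom (i ℕ.+ j) k * binom i j ≈ binom i (j ℕ.+ k) * binom j k
  trinomial zero    j       k       = *-comm _ _
  trinomial (suc i) zero    k       = trans (*-identityʳ _)
    (trans (binom-congˡ k (ℕ.+-identityʳ (suc i))) (sym (*-identityʳ _)))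
  trinomial (suc i) (suc j) zero    = trans (*-comm _ _)
    (*-congʳ (binom-congʳ (suc i) (≡.sym (ℕ.+-identityʳ (suc j)))))
  trinomial (suc i) (suc j) (suc k) = begin
    (binom (i ℕ.+ suc j) (suc k) + q ^ suc (i ℕ.+ suc j) * X) * (B + u * C)
      ≈⟨ *-congʳ (+-congˡ (*-congʳ (^-homo-* q (suc i) (suc j)))) ⟩
    (binom (i ℕ.+ suc j) (suc k) + u * v * X) * (B + u * C)
      ≈⟨ solve 6 (λ Y u v X B C → (Y :+ u :* v :* X) :* (B :+ u :* C)
           := (Y :* B :+ u :* (Y :* C)) :+ u :* v :* (X :* (B :+ u :* C))) refl _ u v X B C ⟩
    (binom (i ℕ.+ suc j) (suc k) * B + u * (binom (i ℕ.+ suc j) (suc k) * C)) + u * v * (X * binom (suc i) (suc j))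
      ≈⟨ +-cong (+-cong (trinomial i (suc j) (suc k))
                        (*-congˡ (trans (*-congʳ (binom-congˡ (suc k) (ℕ.+-suc i j))) (trinomial (suc i) j (suc k)))))
                (*-congˡ (trinomial (suc i) (suc j) k)) ⟩
    (D * binom (suc j) (suc k) + u * (binom (suc i) (j ℕ.+ suc k) * E)) + u * v * (binom (suc i) (suc j ℕ.+ k) * G)
      ≈⟨ +-cong refl (*-congˡ (*-congʳ (binom-congʳ (suc i) (≡.sym (ℕ.+-suc j k))))) ⟩
    (D * (E + v * G) + u * (H * E)) + u * v * (H * G)
      ≈⟨ solve 6 (λ D E v G u H → (D :* (E :+ v :* G) :+ u :* (H :* E)) :+ u :* v :* (H :* G)
           := (D :+ u :* H) :* (E :+ v :* G)) refl D E v G u H ⟩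
    (D + u * H) * (E + v * G)
      ∎
    where
    u = q ^ suc i; v = q ^ suc j
    X = binom (suc i ℕ.+ suc j) k; B = binom i (suc j); C = binom (suc i) j
    D = binom i (suc j ℕ.+ suc k); E = binom j (suc k); G = binom (suc j) k
    H = binom (suc i) (j ℕ.+ suc k)

  -- Signs, parity and quadratic powers of q

  infix 10 ±_

  ±_ : ℕ → Carrier
  ± k = (- 1#) ^ k

  ±-square : ∀ k → ± k * ± k ≈ 1#
  ±-square zero    = *-identityˡ 1#
  ±-square (suc k) = trans (solve 1 (λ s → (:- :1 :* s) :* (:- :1 :* s) := s :* s) refl (± k)) (±-square k)

  -- Recursion in steps of two makes `Odd (2 + n)` and `Odd n` the same type, so a parity hypothesis
  -- can be reused as it stands when a parameter grows by two.
  Odd : ℕ → Set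
  Odd zero          = ⊥
  Odd (suc zero)    = ⊤
  Odd (suc (suc n)) = Odd n

  ±-even : ∀ n → Odd (suc n) → ± n ≈ 1#
  ±-even zero          _ = refl
  ±-even (suc (suc n)) p = trans (solve 1 (λ s → :- :1 :* (:- :1 :* s) := s) refl (± n)) (±-even n p)

  ±-odd : ∀ n → Odd n → ± n ≈ - 1#
  ±-odd (suc n) p = trans (*-congˡ (±-even n p)) (*-identityʳ _)

  -- gauss a k = q^(k(k-1)/2 + ak)
  gauss : ℕ → ℕ → Carrier
  gauss a zero    = 1#
  gauss a (suc k) = q ^ a * gauss (suc a) k

  gauss-suc : ∀ a k → gauss (suc a) k ≈ q ^ k * gauss a k
  gauss-suc a zero    = sym (*-identityˡ 1#)
  gauss-suc a (suc k) = trans (*-congˡ (gauss-suc (suc a) k))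
    (solve 4 (λ q A K g → (q :* A) :* (K :* g) := (q :* K) :* (A :* g)) refl q (q ^ a) (q ^ k) (gauss (suc a) k))

  ^-dbl : ∀ k → q ^ dbl k ≈ q ^ k * q ^ k
  ^-dbl zero    = sym (*-identityˡ 1#)
  ^-dbl (suc k) = trans (*-congˡ (*-congˡ (^-dbl k)))
    (solve 2 (λ q K → q :* (q :* (K :* K)) := (q :* K) :* (q :* K)) refl q (q ^ k))

  -- Pascal's rule on doubled indices produces the weight q^(2k); raising the linear parameter by
  -- two absorbs it. This is where every `2 +` in the relations below comes from.
  gauss-2+ : ∀ a k → gauss (2 ℕ.+ a) k ≈ q ^ dbl k * gauss a k
  gauss-2+ a k = begin
    gauss (2 ℕ.+ a) k            ≈⟨ gauss-suc (suc a) k ⟩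
    q ^ k * gauss (suc a) k      ≈⟨ *-congˡ (gauss-suc a k) ⟩
    q ^ k * (q ^ k * gauss a k)  ≈⟨ *-assoc _ _ _ ⟨
    q ^ k * q ^ k * gauss a k    ≈⟨ *-congʳ (^-dbl k) ⟨
    q ^ dbl k * gauss a k        ∎

  term : (ℕ → ℕ → Carrier) → ℕ → ℕ → ℕ → ℕ → Carrier
  term c a b k l = ± k * (c k l * (gauss a k * gauss b l))

  alt : (ℕ → ℕ → Carrier) → ℕ → ℕ → ℕ → Carrier
  alt c n a b = Σ₊ n (term c a b)

  alt-shift : ∀ c n a b → alt c n (suc a) (suc b) ≈ q ^ n * alt c n a b
  alt-shift c n a b = trans (Σ₊-cong-on n step) (Σ₊-*ˡ n _ _)
    where
    step : ∀ k l → k ℕ.+ l ≡ n → term c (suc a) (suc b) k l ≈ q ^ n * term c a b k l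
    step k l ≡.refl = begin
      ± k * (c k l * (gauss (suc a) k * gauss (suc b) l))
        ≈⟨ *-congˡ (*-congˡ (*-cong (gauss-suc a k) (gauss-suc b l))) ⟩
      ± k * (c k l * ((q ^ k * gauss a k) * (q ^ l * gauss b l)))
        ≈⟨ solve 6 (λ s c K g L h → s :* (c :* ((K :* g) :* (L :* h))) := (K :* L) :* (s :* (c :* (g :* h))))
             refl (± k) (c k l) (q ^ k) (gauss a k) (q ^ l) (gauss b l) ⟩
      (q ^ k * q ^ l) * (± k * (c k l * (gauss a k * gauss b l)))
        ≈⟨ *-congʳ (^-homo-* q k l) ⟨
      q ^ (k ℕ.+ l) * (± k * (c k l * (gauss a k * gauss b l)))
        ∎

  alt-shift₂ : ∀ c n a b → alt c n (2 ℕ.+ a) (2 ℕ.+ b) ≈ q ^ n * (q ^ n * alt c n a b)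
  alt-shift₂ c n a b = trans (alt-shift c n (suc a) (suc b)) (*-congˡ (alt-shift c n a b))

  alt-swap : ∀ c c′ → (∀ k l → c l k ≈ c′ k l) → ∀ n a b → alt c n a b ≈ ± n * alt c′ n b a
  alt-swap c c′ c≈c′ n a b = trans (Σ₊-swap n _) (trans (Σ₊-cong-on n step) (Σ₊-*ˡ n _ _))
    where
    step : ∀ k l → k ℕ.+ l ≡ n → term c a b l k ≈ ± n * term c′ b a k l
    step k l ≡.refl = begin
      ± l * (c l k * (gauss a l * gauss b k))
        ≈⟨ *-cong (trans (sym (*-identityˡ _)) (*-congʳ (sym (±-square k)))) (*-cong (c≈c′ k l) (*-comm _ _)) ⟩
      ± k * ± k * ± l * (c′ k l * (gauss b k * gauss a l))
        ≈⟨ solve 3 (λ s t x → s :* s :* t :* x := (s :* t) :* (s :* x)) refl (± k) (± l) _ ⟩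
      (± k * ± l) * (± k * (c′ k l * (gauss b k * gauss a l)))
        ≈⟨ *-congʳ (^-homo-* (- 1#) k l) ⟨
      ± (k ℕ.+ l) * (± k * (c′ k l * (gauss b k * gauss a l)))
        ∎

  -- The four parity classes and the Pascal relations between them

  ee eo oe oo : ℕ → ℕ → Carrier
  ee k l = binom (dbl k) (dbl l)
  eo k l = binom (dbl k) (suc (dbl l))
  oe k l = binom (suc (dbl k)) (dbl l)
  oo k l = binom (suc (dbl k)) (suc (dbl l))

  altee-swap : ∀ n a b → alt ee n a b ≈ ± n * alt ee n b a
  altee-swap = alt-swap ee ee λ k l → binom-sym (dbl l) (dbl k)

  alteo-swap : ∀ n a b → alt eo n a b ≈ ± n * alt oe n b a
  alteo-swap = alt-swap eo oe λ k l → binom-sym (dbl l) (suc (dbl k))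

  altoe-swap : ∀ n a b → alt oe n a b ≈ ± n * alt eo n b a
  altoe-swap = alt-swap oe eo λ k l → binom-sym (suc (dbl l)) (dbl k)

  altoo-swap : ∀ n a b → alt oo n a b ≈ ± n * alt oo n b a
  altoo-swap = alt-swap oo oo λ k l → binom-sym (suc (dbl l)) (suc (dbl k))

  -- `pascal′` puts its weight on the term with lowered left index, and this weight turns `b` into
  -- `2 + b` there. Lowering the left index also removes one sign, hence the subtraction.
  altee-pascal : ∀ m a b → alt ee (suc m) a b ≈ q ^ b * alt eo m a (suc b) - q ^ a * alt oe m (suc a) (2 ℕ.+ b)
  altee-pascal m a b = begin
    alt ee (suc m) a b
      ≈⟨ Σ₊-split m (term ee a b) (λ k l → q ^ b * T₁ k l) (λ k l → (- q ^ a) * T₂ k l) left right middle ⟩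
    Σ₊ m (λ k l → q ^ b * T₁ k l) + Σ₊ m (λ k l → (- q ^ a) * T₂ k l)
      ≈⟨ +-cong (Σ₊-*ˡ m _ T₁) (Σ₊-*ˡ m _ T₂) ⟩
    q ^ b * alt eo m a (suc b) + (- q ^ a) * alt oe m (suc a) (2 ℕ.+ b)
      ≈⟨ solve 4 (λ B Y A X → B :* Y :+ (:- A) :* X := B :* Y :- A :* X) refl (q ^ b) _ (q ^ a) _ ⟩
    q ^ b * alt eo m a (suc b) - q ^ a * alt oe m (suc a) (2 ℕ.+ b)
      ∎
    where
    T₁ T₂ : ℕ → ℕ → Carrier
    T₁ = term eo a (suc b)
    T₂ = term oe (suc a) (2 ℕ.+ b)
    left : ∀ l → term ee a b 0 (suc l) ≈ q ^ b * T₁ 0 l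
    left l = solve 2 (λ B g → :1 :* (:1 :* (:1 :* (B :* g))) := B :* (:1 :* (:1 :* (:1 :* g))))
      refl (q ^ b) (gauss (suc b) l)
    right : ∀ k → term ee a b (suc k) 0 ≈ (- q ^ a) * T₂ k 0
    right k = solve 3 (λ s A g → (:- :1 :* s) :* (:1 :* ((A :* g) :* :1)) := (:- A) :* (s :* (:1 :* (g :* :1))))
      refl (± k) (q ^ a) (gauss (suc a) k)
    middle : ∀ k l → term ee a b (suc k) (suc l) ≈ q ^ b * T₁ (suc k) l + (- q ^ a) * T₂ k (suc l)
    middle k l = begin
      ± suc k * (ee (suc k) (suc l) * (gauss a (suc k) * gauss b (suc l)))
        ≈⟨ *-congˡ (*-congʳ (pascal′ (suc (dbl k)) (suc (dbl l)))) ⟩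
      ± suc k * ((q ^ dbl (suc l) * oe k (suc l) + eo (suc k) l) * (gauss a (suc k) * gauss b (suc l)))
        ≈⟨ solve 8 (λ s Q X Y A g B h →
             (:- :1 :* s) :* ((Q :* X :+ Y) :* ((A :* g) :* (B :* h)))
             := B :* ((:- :1 :* s) :* (Y :* ((A :* g) :* h))) :+ (:- A) :* (s :* (X :* (g :* (Q :* (B :* h))))))
           refl (± k) (q ^ dbl (suc l)) (oe k (suc l)) (eo (suc k) l) (q ^ a) (gauss (suc a) k) (q ^ b) (gauss (suc b) l) ⟩
      q ^ b * T₁ (suc k) l + (- q ^ a) * (± k * (oe k (suc l) * (gauss (suc a) k * (q ^ dbl (suc l) * gauss b (suc l)))))
        ≈⟨ +-congˡ (*-congˡ (*-congˡ (*-congˡ (*-congˡ (gauss-2+ b (suc l)))))) ⟨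
      q ^ b * T₁ (suc k) l + (- q ^ a) * T₂ k (suc l)
        ∎

  -- Conjugating `altee-pascal` by reversal has the effect of using the other Pascal rule.
  altee-pascal′ : ∀ m a b → alt ee (suc m) a b ≈ q ^ b * alt eo m (2 ℕ.+ a) (suc b) - q ^ a * alt oe m (suc a) b
  altee-pascal′ m a b = begin
    alt ee (suc m) a b
      ≈⟨ altee-swap (suc m) a b ⟩
    ± suc m * alt ee (suc m) b a
      ≈⟨ *-congˡ (altee-pascal m b a) ⟩
    ± suc m * (q ^ a * alt eo m b (suc a) - q ^ b * alt oe m (suc b) (2 ℕ.+ a))
      ≈⟨ solve 5 (λ s A Y B X → (:- :1 :* s) :* (A :* Y :- B :* X) := B :* (s :* X) :- A :* (s :* Y)) refl (± m) (q ^ a) _ (q ^ b) _ ⟩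
    q ^ b * (± m * alt oe m (suc b) (2 ℕ.+ a)) - q ^ a * (± m * alt eo m b (suc a))
      ≈⟨ +-cong (*-congˡ (alteo-swap m (2 ℕ.+ a) (suc b))) (-‿cong (*-congˡ (altoe-swap m (suc a) b))) ⟨
    q ^ b * alt eo m (2 ℕ.+ a) (suc b) - q ^ a * alt oe m (suc a) b
      ∎

  altoo-pascal : ∀ m a b → alt oo m a b ≈ alt eo m a b + q * alt oe m (2 ℕ.+ a) b
  altoo-pascal m a b = begin
    alt oo m a b
      ≈⟨ Σ₊-cong m step ⟩
    Σ₊ m (λ k l → T₁ k l + q * T₂ k l)
      ≈⟨ Σ₊-+ m T₁ (λ k l → q * T₂ k l) ⟩
    alt eo m a b + Σ₊ m (λ k l → q * T₂ k l)
      ≈⟨ +-congˡ (Σ₊-*ˡ m q T₂) ⟩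
    alt eo m a b + q * alt oe m (2 ℕ.+ a) b
      ∎
    where
    T₁ T₂ : ℕ → ℕ → Carrier
    T₁ = term eo a b
    T₂ = term oe (2 ℕ.+ a) b
    step : ∀ k l → term oo a b k l ≈ T₁ k l + q * T₂ k l
    step k l = begin
      ± k * ((eo k l + (q * q ^ dbl k) * oe k l) * (gauss a k * gauss b l))
        ≈⟨ solve 7 (λ s Y q Q X g h →
             s :* ((Y :+ (q :* Q) :* X) :* (g :* h))
             := s :* (Y :* (g :* h)) :+ q :* (s :* (X :* ((Q :* g) :* h))))
             refl (± k) (eo k l) q (q ^ dbl k) (oe k l) (gauss a k) (gauss b l) ⟩
      T₁ k l + q * (± k * (oe k l * ((q ^ dbl k * gauss a k) * gauss b l)))
        ≈⟨ +-congˡ (*-congˡ (*-congˡ (*-congˡ (*-congʳ (gauss-2+ a k))))) ⟨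
      T₁ k l + q * T₂ k l
        ∎

  altoo-pascal′ : ∀ m a b → alt oo m a b ≈ alt oe m a b + q * alt eo m a (2 ℕ.+ b)
  altoo-pascal′ m a b = begin
    alt oo m a b
      ≈⟨ altoo-swap m a b ⟩
    ± m * alt oo m b a
      ≈⟨ *-congˡ (altoo-pascal m b a) ⟩
    ± m * (alt eo m b a + q * alt oe m (2 ℕ.+ b) a)
      ≈⟨ solve 4 (λ s Y q X → s :* (Y :+ q :* X) := s :* Y :+ q :* (s :* X)) refl (± m) _ q _ ⟩
    ± m * alt eo m b a + q * (± m * alt oe m (2 ℕ.+ b) a)
      ≈⟨ +-cong (altoe-swap m a b) (*-congˡ (alteo-swap m a (2 ℕ.+ b))) ⟨
    alt oe m a b + q * alt eo m a (2 ℕ.+ b)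
      ∎

  alteo-pascal : ∀ m a b → alt eo (suc m) a b ≈ alt ee (suc m) a b - q ^ suc a * alt oo m (suc a) (2 ℕ.+ b)
  alteo-pascal m a b = begin
    -- The summand with k = 0 is already that of the `ee` sum, since `eo 0 l` and `ee 0 l` are both
    -- `1#`; Pascal's rule is needed only from k = 1 on.
    U 0 (suc m) + Σ₊ m (λ k → term eo a b (suc k))
      ≈⟨ +-congˡ (Σ₊-cong m step) ⟩
    U 0 (suc m) + Σ₊ m (λ k l → U (suc k) l + (- q ^ suc a) * T k l)
      ≈⟨ +-congˡ (trans (Σ₊-+ m (λ k → U (suc k)) _) (+-congˡ (Σ₊-*ˡ m _ T))) ⟩
    U 0 (suc m) + (Σ₊ m (λ k → U (suc k)) + (- q ^ suc a) * alt oo m (suc a) (2 ℕ.+ b))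
      ≈⟨ solve 4 (λ u v A z → u :+ (v :+ (:- A) :* z) := (u :+ v) :- A :* z) refl (U 0 (suc m)) _ (q ^ suc a) _ ⟩
    alt ee (suc m) a b - q ^ suc a * alt oo m (suc a) (2 ℕ.+ b)
      ∎
    where
    U T : ℕ → ℕ → Carrier
    U = term ee a b
    T = term oo (suc a) (2 ℕ.+ b)
    step : ∀ k l → term eo a b (suc k) l ≈ U (suc k) l + (- q ^ suc a) * T k l
    step k l = begin
      ± suc k * (eo (suc k) l * (gauss a (suc k) * gauss b l))
        ≈⟨ *-congˡ (*-congʳ (pascal′ (suc (dbl k)) (dbl l))) ⟩
      ± suc k * (((q * q ^ dbl l) * oo k l + ee (suc k) l) * (gauss a (suc k) * gauss b l))
        ≈⟨ solve 8 (λ s q Q X Y A g h →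
             (:- :1 :* s) :* (((q :* Q) :* X :+ Y) :* ((A :* g) :* h))
             := (:- :1 :* s) :* (Y :* ((A :* g) :* h)) :+ (:- (q :* A)) :* (s :* (X :* (g :* (Q :* h)))))
           refl (± k) q (q ^ dbl l) (oo k l) (ee (suc k) l) (q ^ a) (gauss (suc a) k) (gauss b l) ⟩
      U (suc k) l + (- q ^ suc a) * (± k * (oo k l * (gauss (suc a) k * (q ^ dbl l * gauss b l))))
        ≈⟨ +-congˡ (*-congˡ (*-congˡ (*-congˡ (*-congˡ (gauss-2+ b l))))) ⟨
      U (suc k) l + (- q ^ suc a) * T k l
        ∎

  -- Divisibility of the alternating sums

  -- (-q;q)_n
  poch : ℕ → Carrier
  poch zero    = 1#
  poch (suc n) = poch n * (1# + q ^ suc n)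

  odd-suc-suc : ∀ a b n → Odd (suc a ℕ.+ suc b ℕ.+ n) → Odd (a ℕ.+ b ℕ.+ n)
  odd-suc-suc a b n = ≡.subst Odd (≡.cong (λ x → suc (x ℕ.+ n)) (ℕ.+-suc a b))

  odd-+-suc : ∀ a b n → Odd (a ℕ.+ b ℕ.+ suc n) → Odd (suc a ℕ.+ b ℕ.+ n)
  odd-+-suc a b n = ≡.subst Odd (ℕ.+-suc (a ℕ.+ b) n)

  odd-suc-+ : ∀ a b n → Odd (a ℕ.+ b ℕ.+ suc n) → Odd (a ℕ.+ suc b ℕ.+ n)
  odd-suc-+ a b n = ≡.subst Odd (≡.trans (ℕ.+-suc (a ℕ.+ b) n) (≡.cong (ℕ._+ n) (≡.sym (ℕ.+-suc a b))))

  odd-swap : ∀ a b n → Odd (a ℕ.+ b ℕ.+ n) → Odd (b ℕ.+ a ℕ.+ n)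
  odd-swap a b n = ≡.subst Odd (≡.cong (ℕ._+ n) (ℕ.+-comm a b))

  -- Simultaneous shifts and reversal reduce to b = 0. There `a` moves in steps of two, and the
  -- parity of `n` decides whether the descent ends at 0 or at 1.
  parity-induction : ∀ {p} (P : ℕ → ℕ → Set p) n →
    (Odd n → P 0 0) → (Odd (suc n) → P 1 0) →
    (∀ a → Odd (a ℕ.+ 0 ℕ.+ n) → P a 0 → P (2 ℕ.+ a) 0) →
    (∀ a b → P a b → P (suc a) (suc b)) →
    (∀ a b → P a b → P b a) →
    ∀ a b → Odd (a ℕ.+ b ℕ.+ n) → P a b
  parity-induction P n P₀₀ P₁₀ step shift swap = go
    where
    column : ∀ a → Odd (a ℕ.+ 0 ℕ.+ n) → P a 0
    column zero          odd = P₀₀ odd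
    column (suc zero)    odd = P₁₀ odd
    column (suc (suc a)) odd = step a odd (column a odd)
    go : ∀ a b → Odd (a ℕ.+ b ℕ.+ n) → P a b
    go a       zero    odd = column a odd
    go zero    (suc b) odd = swap (suc b) 0 (column (suc b) (odd-swap 0 (suc b) n odd))
    go (suc a) (suc b) odd = shift a b (go a b (odd-suc-suc a b n odd))

  x+-1x≈0 : ∀ x → x + - 1# * x ≈ 0#
  x+-1x≈0 x = trans (solve 1 (λ x → x :+ (:- :1) :* x := x :- x) refl x) (-‿inverseʳ x)

  poch-gain : ∀ n {x} → poch n ∣ x → poch (suc n) ∣ x * (1# + q ^ suc n)
  poch-gain n = x∣ʳy⇒xz∣ʳyz (1# + q ^ suc n)

  poch-gain² : ∀ n {x} → poch n ∣ x → poch (suc n) ∣ x * (1# - q ^ suc n * q ^ suc n)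
  poch-gain² n {x} d = ∣ʳ-respʳ-≈
    (solve 2 (λ x Q → x :* (:1 :+ Q) :* (:1 :- Q) := x :* (:1 :- Q :* Q)) refl x (q ^ suc n))
    (∣-*ʳ (1# - q ^ suc n) (poch-gain n d))

  module Divisibility
    (halve : ∀ n {x} → poch n ∣ x + x → poch n ∣ x)
    where

    module Step (m : ℕ) (eo-div : ∀ a b → Odd (a ℕ.+ b ℕ.+ m) → poch m ∣ alt eo m a b) where

      Q : Carrier
      Q = q ^ suc m

      oe-div : ∀ a b → Odd (a ℕ.+ b ℕ.+ m) → poch m ∣ alt oe m a b
      oe-div a b odd = ∣ʳ-respʳ-≈ (sym (altoe-swap m a b))
        (x∣ʳy⇒x∣ʳzy (± m) (eo-div b a (odd-swap a b m odd)))

      -- Expanding at `2 + a` by one Pascal rule and at `a` by the other gives the same `eo` sum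
      -- `y`. The two `oe` sums are shifts of one another, so the difference is a multiple of
      -- `x * (1# - Q * Q)`.
      ee-step : ∀ a → Odd (a ℕ.+ 0 ℕ.+ suc m) →
                poch (suc m) ∣ alt ee (suc m) a 0 → poch (suc m) ∣ alt ee (suc m) (2 ℕ.+ a) 0
      ee-step a odd d = ∣ʳ-respʳ-≈ (sym eq)
        (∣-+ d (x∣ʳy⇒x∣ʳzy (q ^ a) (poch-gain² m (oe-div (suc a) 0 (odd-+-suc a 0 m odd)))))
        where
        x = alt oe m (suc a) 0
        y = alt eo m (2 ℕ.+ a) 1
        eq : alt ee (suc m) (2 ℕ.+ a) 0 ≈ alt ee (suc m) a 0 + q ^ a * (x * (1# - Q * Q))
        eq = begin
          alt ee (suc m) (2 ℕ.+ a) 0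
            ≈⟨ altee-pascal m (2 ℕ.+ a) 0 ⟩
          1# * y - q ^ (2 ℕ.+ a) * alt oe m (3 ℕ.+ a) 2
            ≈⟨ +-congˡ (-‿cong (*-congˡ (alt-shift₂ oe m (suc a) 0))) ⟩
          1# * y - (q * (q * q ^ a)) * (q ^ m * (q ^ m * x))
            ≈⟨ solve 5 (λ y q A M x → :1 :* y :- (q :* (q :* A)) :* (M :* (M :* x))
                 := (:1 :* y :- A :* x) :+ A :* (x :* (:1 :- (q :* M) :* (q :* M)))) refl y q (q ^ a) (q ^ m) x ⟩
          (1# * y - q ^ a * x) + q ^ a * (x * (1# - Q * Q))
            ≈⟨ +-congʳ (altee-pascal′ m a 0) ⟨
          alt ee (suc m) a 0 + q ^ a * (x * (1# - Q * Q))
            ∎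

      -- Reversing the sum gives alt ee (suc m) 0 0 ≈ - alt ee (suc m) 0 0.
      ee-00 : Odd (suc m) → poch (suc m) ∣ alt ee (suc m) 0 0
      ee-00 odd = halve (suc m) (∣ʳ-respʳ-≈ (sym eq) (poch (suc m) ∣0))
        where
        eq : alt ee (suc m) 0 0 + alt ee (suc m) 0 0 ≈ 0#
        eq = begin
          alt ee (suc m) 0 0 + alt ee (suc m) 0 0
            ≈⟨ +-congˡ (trans (altee-swap (suc m) 0 0) (*-congʳ (±-odd (suc m) odd))) ⟩
          alt ee (suc m) 0 0 + - 1# * alt ee (suc m) 0 0
            ≈⟨ x+-1x≈0 (alt ee (suc m) 0 0) ⟩
          0#
            ∎

      -- Here m is odd, so the `oe` sum in Pascal's rule is, after a shift, minus the reversal of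
      -- the `eo` sum `y`. Both terms are then multiples of `y` and combine to the factor `1# + Q`.
      ee-10 : Odd (suc (suc m)) → poch (suc m) ∣ alt ee (suc m) 1 0
      ee-10 odd = ∣ʳ-respʳ-≈ (sym eq) (poch-gain m (eo-div 1 1 odd))
        where
        y = alt eo m 1 1
        eq : alt ee (suc m) 1 0 ≈ y * (1# + Q)
        eq = begin
          alt ee (suc m) 1 0
            ≈⟨ altee-pascal m 1 0 ⟩
          1# * y - q ^ 1 * alt oe m 2 2
            ≈⟨ +-congˡ (-‿cong (*-congˡ (trans (alt-shift oe m 1 1)
                 (*-congˡ (trans (altoe-swap m 1 1) (*-congʳ (±-odd m odd))))))) ⟩
          1# * y - (q * 1#) * (q ^ m * (- 1# * y))
            ≈⟨ solve 3 (λ y q M → :1 :* y :- (q :* :1) :* (M :* ((:- :1) :* y)) := y :* (:1 :+ q :* M)) refl y q (q ^ m) ⟩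
          y * (1# + Q)
            ∎

      shift : ∀ c n → (∀ a b → poch (suc m) ∣ alt c n a b → poch (suc m) ∣ alt c n (suc a) (suc b))
      shift c n a b d = ∣ʳ-respʳ-≈ (sym (alt-shift c n a b)) (x∣ʳy⇒x∣ʳzy (q ^ n) d)

      ee-div : ∀ a b → Odd (a ℕ.+ b ℕ.+ suc m) → poch (suc m) ∣ alt ee (suc m) a b
      ee-div = parity-induction (λ a b → poch (suc m) ∣ alt ee (suc m) a b) (suc m) ee-00 ee-10 ee-step
        (shift ee (suc m))
        (λ a b d → ∣ʳ-respʳ-≈ (sym (altee-swap (suc m) b a)) (x∣ʳy⇒x∣ʳzy (± suc m) d))

      -- The two Pascal rules, one applied at `2 + a` and the other at `a`, involve the same `oe`
      -- sum `x`, and their `eo` sums agree up to a shift.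
      oo-recurrence : ∀ a b → alt oo m (2 ℕ.+ a) b
        ≈ q * (q ^ m * (q ^ m * alt oo m a b)) + alt oe m (2 ℕ.+ a) b * (1# - Q * Q)
      oo-recurrence a b = begin
        alt oo m (2 ℕ.+ a) b
          ≈⟨ altoo-pascal′ m (2 ℕ.+ a) b ⟩
        x + q * alt eo m (2 ℕ.+ a) (2 ℕ.+ b)
          ≈⟨ +-congˡ (*-congˡ (alt-shift₂ eo m a b)) ⟩
        x + q * (q ^ m * (q ^ m * y))
          ≈⟨ solve 4 (λ x q M y → x :+ q :* (M :* (M :* y))
               := q :* (M :* (M :* (y :+ q :* x))) :+ x :* (:1 :- (q :* M) :* (q :* M))) refl x q (q ^ m) y ⟩
        q * (q ^ m * (q ^ m * (y + q * x))) + x * (1# - Q * Q)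
          ≈⟨ +-congʳ (*-congˡ (*-congˡ (*-congˡ (altoo-pascal m a b)))) ⟨
        q * (q ^ m * (q ^ m * alt oo m a b)) + x * (1# - Q * Q)
          ∎
        where
        x = alt oe m (2 ℕ.+ a) b
        y = alt eo m a b

      oo-step : ∀ a → Odd (a ℕ.+ 0 ℕ.+ m) →
                poch (suc m) ∣ alt oo m a 0 → poch (suc m) ∣ alt oo m (2 ℕ.+ a) 0
      oo-step a odd d = ∣ʳ-respʳ-≈ (sym (oo-recurrence a 0))
        (∣-+ (x∣ʳy⇒x∣ʳzy q (x∣ʳy⇒x∣ʳzy (q ^ m) (x∣ʳy⇒x∣ʳzy (q ^ m) d)))
             (poch-gain² m (oe-div (2 ℕ.+ a) 0 odd)))

      oo-00 : Odd m → poch (suc m) ∣ alt oo m 0 0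
      oo-00 odd = halve (suc m) (∣ʳ-respʳ-≈ (sym eq) (poch (suc m) ∣0))
        where
        eq : alt oo m 0 0 + alt oo m 0 0 ≈ 0#
        eq = begin
          alt oo m 0 0 + alt oo m 0 0
            ≈⟨ +-congˡ (trans (altoo-swap m 0 0) (*-congʳ (±-odd m odd))) ⟩
          alt oo m 0 0 + - 1# * alt oo m 0 0
            ≈⟨ x+-1x≈0 (alt oo m 0 0) ⟩
          0#
            ∎

      -- For even m reversal carries no sign. Instead, `o` is expanded by one Pascal rule, and
      -- `Q * o`, rewritten by reversal and a shift, by the other. Eliminating the common `eo` sum
      -- gives `o + o` as a combination in which `x` and `o`, both multiples of `poch m`, acquire
      -- factors containing `1# + Q`.
      oo-10 : Odd (suc m) → poch (suc m) ∣ alt oo m 1 0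
      oo-10 odd = halve (suc m) (∣ʳ-respʳ-≈ eq
        (∣-+ (poch-gain² m (oe-div 1 0 odd)) (poch-gain m o-div)))
        where
        o = alt oo m 1 0
        x = alt oe m 1 0
        o-div : poch m ∣ o
        o-div = ∣ʳ-respʳ-≈ (sym (altoo-pascal m 1 0))
          (∣-+ (eo-div 1 0 odd) (x∣ʳy⇒x∣ʳzy q (oe-div 3 0 odd)))
        o≈ : o ≈ x + q * alt eo m 1 2
        o≈ = altoo-pascal′ m 1 0
        y≈ : Q * o ≈ q * alt eo m 1 2 + x * (Q * Q)
        y≈ = begin
          Q * o
            ≈⟨ *-assoc _ _ _ ⟩
          q * (q ^ m * o)
            ≈⟨ *-congˡ (*-congˡ (trans (altoo-swap m 1 0) (trans (*-congʳ (±-even m odd)) (*-identityˡ _)))) ⟩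
          q * (q ^ m * alt oo m 0 1)
            ≈⟨ *-congˡ (alt-shift oo m 0 1) ⟨
          q * alt oo m 1 2
            ≈⟨ *-congˡ (altoo-pascal m 1 2) ⟩
          q * (alt eo m 1 2 + q * alt oe m 3 2)
            ≈⟨ *-congˡ (+-congˡ (*-congˡ (alt-shift₂ oe m 1 0))) ⟩
          q * (alt eo m 1 2 + q * (q ^ m * (q ^ m * x)))
            ≈⟨ solve 4 (λ q y M x → q :* (y :+ q :* (M :* (M :* x))) := q :* y :+ x :* ((q :* M) :* (q :* M)))
                 refl q (alt eo m 1 2) (q ^ m) x ⟩
          q * alt eo m 1 2 + x * (Q * Q)
            ∎
        eq : x * (1# - Q * Q) + o * (1# + Q) ≈ o + o
        eq = begin
          x * (1# - Q * Q) + o * (1# + Q)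
            ≈⟨ solve 3 (λ x o Q → x :* (:1 :- Q :* Q) :+ o :* (:1 :+ Q) := (x :- x :* (Q :* Q)) :+ o :+ Q :* o) refl x o Q ⟩
          (x - x * (Q * Q)) + o + Q * o
            ≈⟨ +-congˡ y≈ ⟩
          (x - x * (Q * Q)) + o + (q * alt eo m 1 2 + x * (Q * Q))
            ≈⟨ solve 4 (λ x Q o y → (x :- x :* Q) :+ o :+ (y :+ x :* Q) := o :+ (x :+ y)) refl x (Q * Q) o _ ⟩
          o + (x + q * alt eo m 1 2)
            ≈⟨ +-congˡ o≈ ⟨
          o + o
            ∎

      oo-div : ∀ a b → Odd (a ℕ.+ b ℕ.+ m) → poch (suc m) ∣ alt oo m a b
      oo-div = parity-induction (λ a b → poch (suc m) ∣ alt oo m a b) m oo-00 oo-10 oo-step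
        (shift oo m)
        (λ a b d → ∣ʳ-respʳ-≈ (sym (altoo-swap m b a)) (x∣ʳy⇒x∣ʳzy (± m) d))

    alteo-divisible : ∀ m a b → Odd (a ℕ.+ b ℕ.+ m) → poch m ∣ alt eo m a b
    alteo-divisible zero    a b odd = _ , *-identityʳ _
    alteo-divisible (suc m) a b odd = ∣ʳ-respʳ-≈ (sym (alteo-pascal m a b))
      (∣-+ (ee-div a b odd) (∣-neg (x∣ʳy⇒x∣ʳzy (q ^ suc a)
        (oo-div (suc a) (2 ℕ.+ b) (odd-suc-+ (suc a) (suc b) m (≡.subst Odd eq odd))))))
      where
      open Step m (alteo-divisible m)
      eq : 2 ℕ.+ (a ℕ.+ b ℕ.+ suc m) ≡ suc a ℕ.+ suc b ℕ.+ suc m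
      eq = ≡.cong (λ n → suc (n ℕ.+ suc m)) (≡.sym (ℕ.+-suc a b))

    altee-divisible : ∀ n a b → Odd (a ℕ.+ b ℕ.+ n) → poch n ∣ alt ee n a b
    altee-divisible zero    a b odd = _ , *-identityʳ _
    altee-divisible (suc n) = Step.ee-div n (alteo-divisible n)

  -- The q-binomial theorem and its even part

  1^n≈1 : ∀ n → 1# ^ n ≈ 1#
  1^n≈1 zero    = refl
  1^n≈1 (suc n) = trans (*-identityˡ _) (1^n≈1 n)

  ±-dbl : ∀ k → ± dbl k ≈ 1#
  ±-dbl zero    = refl
  ±-dbl (suc k) = trans (solve 1 (λ s → :- :1 :* (:- :1 :* s) := s) refl (± dbl k)) (±-dbl k)

  qsum : Carrier → ℕ → ℕ → Carrier
  qsum ε n a = Σ₊ n λ i j → binom i j * (ε ^ i * gauss a i)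

  -- Pascal's rule peels the first factor off the product of all 1 + ε q^(a+j) with j < n + 1.
  q-binomial : ∀ ε n a → qsum ε (suc n) a ≈ (1# + ε * q ^ a) * qsum ε n (suc a)
  q-binomial ε n a = begin
    qsum ε (suc n) a
      ≈⟨ Σ₊-split n T₀ T (λ i j → (ε * q ^ a) * T i j) (λ _ → refl) right middle ⟩
    Σ₊ n T + Σ₊ n (λ i j → (ε * q ^ a) * T i j)
      ≈⟨ +-congˡ (Σ₊-*ˡ n _ T) ⟩
    Σ₊ n T + (ε * q ^ a) * Σ₊ n T
      ≈⟨ solve 2 (λ z t → t :+ z :* t := (:1 :+ z) :* t) refl (ε * q ^ a) _ ⟩
    (1# + ε * q ^ a) * qsum ε n (suc a)
      ∎
    where
    T₀ T : ℕ → ℕ → Carrier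
    T₀ i j = binom i j * (ε ^ i * gauss a i)
    T  i j = binom i j * (ε ^ i * gauss (suc a) i)
    right : ∀ i → T₀ (suc i) 0 ≈ (ε * q ^ a) * T i 0
    right i = trans (*-congʳ (sym (binom-0 i)))
      (solve 5 (λ b e E A g → b :* ((e :* E) :* (A :* g)) := (e :* A) :* (b :* (E :* g)))
        refl (binom i 0) ε (ε ^ i) (q ^ a) (gauss (suc a) i))
    middle : ∀ i j → T₀ (suc i) (suc j) ≈ T (suc i) j + (ε * q ^ a) * T i (suc j)
    middle i j = begin
      (B + U * C) * ((ε * ε ^ i) * (q ^ a * g))
        ≈⟨ solve 7 (λ B U C e E A g → (B :+ U :* C) :* ((e :* E) :* (A :* g))
             := C :* ((e :* E) :* (U :* (A :* g))) :+ (e :* A) :* (B :* (E :* g))) refl B U C ε (ε ^ i) (q ^ a) g ⟩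
      C * ((ε * ε ^ i) * (U * (q ^ a * g))) + (ε * q ^ a) * T i (suc j)
        ≈⟨ +-congʳ (*-congˡ (*-congˡ (gauss-suc a (suc i)))) ⟨
      T (suc i) j + (ε * q ^ a) * T i (suc j)
        ∎
      where B = binom i (suc j); C = binom (suc i) j; U = q ^ suc i; g = gauss (suc a) i

  poch-*-qsum : ∀ n a → poch a * qsum 1# n (suc a) ≈ poch (n ℕ.+ a)
  poch-*-qsum zero    a = solve 1 (λ p → p :* (:1 :* (:1 :* :1)) := p) refl (poch a)
  poch-*-qsum (suc n) a = begin
    poch a * qsum 1# (suc n) (suc a)
      ≈⟨ *-congˡ (q-binomial 1# n (suc a)) ⟩
    poch a * ((1# + 1# * q ^ suc a) * qsum 1# n (2 ℕ.+ a))
      ≈⟨ solve 3 (λ p Q t → p :* ((:1 :+ :1 :* Q) :* t) := (p :* (:1 :+ Q)) :* t) refl (poch a) (q ^ suc a) _ ⟩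
    poch (suc a) * qsum 1# n (2 ℕ.+ a)
      ≈⟨ poch-*-qsum n (suc a) ⟩
    poch (n ℕ.+ suc a)
      ≡⟨ ≡.cong poch (ℕ.+-suc n a) ⟩
    poch (suc n ℕ.+ a)
      ∎

  poch-∣-+ : ∀ k m → poch m ∣ poch (k ℕ.+ m)
  poch-∣-+ zero    m = 1# , *-identityˡ _
  poch-∣-+ (suc k) m = ∣-*ʳ _ (poch-∣-+ k m)

  evenSum : ℕ → Carrier
  evenSum m = Σ₊ m λ k l → ee k l * gauss 0 (dbl k)

  -- Adding the expansions for ε = 1 and ε = -1 cancels the odd indices. The factor 2 stays, since 2
  -- need not be invertible.
  evenSum-double : ∀ m → qsum 1# (dbl m) 0 + qsum (- 1#) (dbl m) 0 ≈ evenSum m + evenSum m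
  evenSum-double m = begin
    Σ₊ (dbl m) (T 1#) + Σ₊ (dbl m) (T (- 1#))
      ≈⟨ Σ₊-+ (dbl m) (T 1#) (T (- 1#)) ⟨
    Σ₊ (dbl m) (λ i j → T 1# i j + T (- 1#) i j)
      ≈⟨ Σ₊-even m (λ i j → T 1# i j + T (- 1#) i j) odd ⟩
    Σ₊ m (λ k l → T 1# (dbl k) (dbl l) + T (- 1#) (dbl k) (dbl l))
      ≈⟨ Σ₊-cong m even ⟩
    Σ₊ m (λ k l → ee k l * gauss 0 (dbl k) + ee k l * gauss 0 (dbl k))
      ≈⟨ Σ₊-+ m _ _ ⟩
    evenSum m + evenSum m
      ∎
    where
    T : Carrier → ℕ → ℕ → Carrier
    T ε i j = binom i j * (ε ^ i * gauss 0 i)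
    odd : ∀ k l → T 1# (suc (dbl k)) l + T (- 1#) (suc (dbl k)) l ≈ 0#
    odd k l = begin
      b * ((1# * 1# ^ dbl k) * g) + b * ((- 1# * ± dbl k) * g)
        ≈⟨ +-cong (*-congˡ (*-congʳ (*-congˡ (1^n≈1 (dbl k))))) (*-congˡ (*-congʳ (*-congˡ (±-dbl k)))) ⟩
      b * ((1# * 1#) * g) + b * ((- 1# * 1#) * g)
        ≈⟨ solve 2 (λ b g → b :* ((:1 :* :1) :* g) :+ b :* ((:- :1 :* :1) :* g) := b :* g :+ (:- :1) :* (b :* g)) refl b g ⟩
      b * g + - 1# * (b * g)
        ≈⟨ x+-1x≈0 _ ⟩
      0#
        ∎
      where b = binom (suc (dbl k)) l; g = gauss 0 (suc (dbl k))
    even : ∀ k l → T 1# (dbl k) (dbl l) + T (- 1#) (dbl k) (dbl l)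
                 ≈ ee k l * gauss 0 (dbl k) + ee k l * gauss 0 (dbl k)
    even k l = +-cong (*-congˡ (trans (*-congʳ (1^n≈1 (dbl k))) (*-identityˡ _)))
                      (*-congˡ (trans (*-congʳ (±-dbl k)) (*-identityˡ _)))

  dbl-suc : ∀ m → m ℕ.+ suc m ≡ suc (dbl m)
  dbl-suc zero    = ≡.refl
  dbl-suc (suc m) = ≡.cong suc (≡.trans (ℕ.+-suc m (suc m)) (≡.cong suc (dbl-suc m)))

  gauss-shift : ∀ m a k → gauss (m ℕ.+ a) k ≈ (q ^ k) ^ m * gauss a k
  gauss-shift zero    a k = sym (*-identityˡ _)
  gauss-shift (suc m) a k = begin
    gauss (suc (m ℕ.+ a)) k              ≈⟨ gauss-suc (m ℕ.+ a) k ⟩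
    q ^ k * gauss (m ℕ.+ a) k            ≈⟨ *-congˡ (gauss-shift m a k) ⟩
    q ^ k * ((q ^ k) ^ m * gauss a k)    ≈⟨ *-assoc _ _ _ ⟨
    (q ^ k) ^ suc m * gauss a k          ∎

  gauss-+ : ∀ a k l → gauss a (k ℕ.+ l) ≈ gauss a k * gauss (k ℕ.+ a) l
  gauss-+ a zero    l = sym (*-identityˡ _)
  gauss-+ a (suc k) l = begin
    q ^ a * gauss (suc a) (k ℕ.+ l)
      ≈⟨ *-congˡ (gauss-+ (suc a) k l) ⟩
    q ^ a * (gauss (suc a) k * gauss (k ℕ.+ suc a) l)
      ≡⟨ ≡.cong (λ n → q ^ a * (gauss (suc a) k * gauss n l)) (ℕ.+-suc k a) ⟩
    q ^ a * (gauss (suc a) k * gauss (suc k ℕ.+ a) l)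
      ≈⟨ *-assoc _ _ _ ⟨
    gauss a (suc k) * gauss (suc k ℕ.+ a) l
      ∎

  -- Multiplication of even series

  infixl 7 _⋆_

  -- The product of power series, read on coefficients with respect to x²ⁿ/(q;q)₂ₙ.
  _⋆_ : (ℕ → Carrier) → (ℕ → Carrier) → ℕ → Carrier
  (f ⋆ g) n = Σ₊ n λ k l → ee k l * (f k * g l)

  ⋆-comm : ∀ f g n → (f ⋆ g) n ≈ (g ⋆ f) n
  ⋆-comm f g n = trans (Σ₊-swap n _)
    (Σ₊-cong n λ k l → *-cong (binom-sym (dbl l) (dbl k)) (*-comm (f l) (g k)))

  ⋆-congˡ : ∀ f {g g′} → (∀ n → g n ≈ g′ n) → ∀ n → (f ⋆ g) n ≈ (f ⋆ g′) n
  ⋆-congˡ f g≈g′ n = Σ₊-cong n λ k l → *-congˡ (*-congˡ (g≈g′ l))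

  ⋆-assoc : ∀ f g h n → ((f ⋆ g) ⋆ h) n ≈ (f ⋆ (g ⋆ h)) n
  ⋆-assoc f g h n = begin
    Σ₊ n (λ k m → ee k m * ((f ⋆ g) k * h m))
      ≈⟨ Σ₊-cong n expandˡ ⟩
    Σ₊ n (λ k m → Σ₊ k λ i j → (ee k m * h m) * (ee i j * (f i * g j)))
      ≈⟨ Σ₊-cong n (λ k m → Σ₊-cong-on k (regroup m)) ⟩
    Σ₊ n (λ k m → Σ₊ k λ i j → T i j m)
      ≈⟨ Σ₊-assoc n T ⟩
    Σ₊ n (λ i k → Σ₊ k λ j m → T i j m)
      ≈⟨ Σ₊-cong n (λ i k → Σ₊-cong-on k (ungroup i)) ⟨
    Σ₊ n (λ i k → Σ₊ k λ j m → (ee i k * f i) * (ee j m * (g j * h m)))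
      ≈⟨ Σ₊-cong n expandʳ ⟨
    Σ₊ n (λ i k → ee i k * (f i * (g ⋆ h) k))
      ∎
    where
    T : ℕ → ℕ → ℕ → Carrier
    T i j m = (binom (dbl i) (dbl j ℕ.+ dbl m) * ee j m) * (f i * g j * h m)
    expandˡ : ∀ k m → ee k m * ((f ⋆ g) k * h m) ≈ Σ₊ k λ i j → (ee k m * h m) * (ee i j * (f i * g j))
    expandˡ k m = trans (solve 3 (λ e s x → e :* (s :* x) := (e :* x) :* s) refl (ee k m) _ (h m))
      (sym (Σ₊-*ˡ k (ee k m * h m) λ i j → ee i j * (f i * g j)))
    expandʳ : ∀ i k → ee i k * (f i * (g ⋆ h) k) ≈ Σ₊ k λ j m → (ee i k * f i) * (ee j m * (g j * h m))
    expandʳ i k = trans (sym (*-assoc _ _ _))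
      (sym (Σ₊-*ˡ k (ee i k * f i) λ j m → ee j m * (g j * h m)))
    regroup : ∀ {k} m i j → i ℕ.+ j ≡ k → (ee k m * h m) * (ee i j * (f i * g j)) ≈ T i j m
    regroup m i j ≡.refl = begin
      (ee (i ℕ.+ j) m * h m) * (ee i j * (f i * g j))
        ≈⟨ *-congʳ (*-congʳ (binom-congˡ (dbl m) (dbl-+ i j))) ⟩
      (binom (dbl i ℕ.+ dbl j) (dbl m) * h m) * (ee i j * (f i * g j))
        ≈⟨ solve 5 (λ b c x y z → (b :* z) :* (c :* (x :* y)) := (b :* c) :* (x :* y :* z)) refl _ _ (f i) (g j) (h m) ⟩
      (binom (dbl i ℕ.+ dbl j) (dbl m) * ee i j) * (f i * g j * h m)
        ≈⟨ *-congʳ (trinomial (dbl i) (dbl j) (dbl m)) ⟩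
      T i j m
        ∎
    ungroup : ∀ {k} i j m → j ℕ.+ m ≡ k → (ee i k * f i) * (ee j m * (g j * h m)) ≈ T i j m
    ungroup i j m ≡.refl = begin
      (ee i (j ℕ.+ m) * f i) * (ee j m * (g j * h m))
        ≈⟨ *-congʳ (*-congʳ (binom-congʳ (dbl i) (dbl-+ j m))) ⟩
      (binom (dbl i) (dbl j ℕ.+ dbl m) * f i) * (ee j m * (g j * h m))
        ≈⟨ solve 5 (λ b c x y z → (b :* x) :* (c :* (y :* z)) := (b :* c) :* (x :* y :* z)) refl _ _ (f i) (g j) (h m) ⟩
      T i j m
        ∎

  -- The series of the defining identity and their products with `cos`

  cos den num : ℕ → Carrier
  cos n = ± n
  den n = ± n * gauss 0 (dbl n)
  num n = q ^ (n ℕ.* (n ℕ.∸ 1))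

  cos⋆den : ∀ n → (cos ⋆ den) n ≈ ± n * evenSum n
  cos⋆den n = begin
    (cos ⋆ den) n                                      ≈⟨ ⋆-comm cos den n ⟩
    (den ⋆ cos) n                                      ≈⟨ Σ₊-cong-on n step ⟩
    Σ₊ n (λ k l → ± n * (ee k l * gauss 0 (dbl k)))    ≈⟨ Σ₊-*ˡ n (± n) _ ⟩
    ± n * evenSum n                                    ∎
    where
    step : ∀ k l → k ℕ.+ l ≡ n → ee k l * (den k * cos l) ≈ ± n * (ee k l * gauss 0 (dbl k))
    step k l ≡.refl = trans
      (solve 4 (λ e s g t → e :* ((s :* g) :* t) := (s :* t) :* (e :* g)) refl (ee k l) (± k) _ (± l))
      (*-congʳ (sym (^-homo-* (- 1#) k l)))

  gauss-diagonal : ∀ l → gauss l l ≈ gauss 1 l * num l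
  gauss-diagonal zero    = sym (*-identityˡ 1#)
  gauss-diagonal (suc l) = begin
    gauss (suc l) (suc l)                   ≡⟨ ≡.cong (λ a → gauss a (suc l)) (ℕ.+-comm 1 l) ⟩
    gauss (l ℕ.+ 1) (suc l)                 ≈⟨ gauss-shift l 1 (suc l) ⟩
    (q ^ suc l) ^ l * gauss 1 (suc l)       ≈⟨ *-comm _ _ ⟩
    gauss 1 (suc l) * (q ^ suc l) ^ l       ≈⟨ *-congˡ (^-assocʳ q (suc l) l) ⟩
    gauss 1 (suc l) * num (suc l)           ∎

  -- The origin of the parameters 1 and n in `cos⋆num`: since C(k+l,2) = C(k,2) + C(l,2) + kl, the
  -- exponent of `num l` becomes one of the admissible form once the power `gauss 1 n`, which
  -- depends only on n = k + l, is factored in.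
  gauss-num : ∀ k l → gauss 1 k * gauss (k ℕ.+ l) l ≈ gauss 1 (k ℕ.+ l) * num l
  gauss-num k l = begin
    gauss 1 k * gauss (k ℕ.+ l) l
      ≈⟨ *-congˡ (trans (gauss-shift k l l) (*-congˡ (gauss-diagonal l))) ⟩
    gauss 1 k * ((q ^ l) ^ k * (gauss 1 l * num l))
      ≈⟨ solve 4 (λ g K h x → g :* (K :* (h :* x)) := (g :* (K :* h)) :* x) refl (gauss 1 k) _ _ _ ⟩
    (gauss 1 k * ((q ^ l) ^ k * gauss 1 l)) * num l
      ≈⟨ *-congʳ (trans (gauss-+ 1 k l) (*-congˡ (gauss-shift k 1 l))) ⟨
    gauss 1 (k ℕ.+ l) * num l
      ∎

  cos⋆num : ∀ n → alt ee n 1 n ≈ gauss 1 n * (cos ⋆ num) n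
  cos⋆num n = trans (Σ₊-cong-on n step) (Σ₊-*ˡ n _ _)
    where
    step : ∀ k l → k ℕ.+ l ≡ n → term ee 1 n k l ≈ gauss 1 n * (ee k l * (cos k * num l))
    step k l ≡.refl = begin
      ± k * (ee k l * (gauss 1 k * gauss (k ℕ.+ l) l))
        ≈⟨ *-congˡ (*-congˡ (gauss-num k l)) ⟩
      ± k * (ee k l * (gauss 1 (k ℕ.+ l) * num l))
        ≈⟨ solve 4 (λ s e g x → s :* (e :* (g :* x)) := g :* (e :* (s :* x))) refl (± k) (ee k l) _ _ ⟩
      gauss 1 (k ℕ.+ l) * (ee k l * (cos k * num l))
        ∎

  odd-1+n+n : ∀ n → Odd (1 ℕ.+ n ℕ.+ n)
  odd-1+n+n zero    = _
  odd-1+n+n (suc n) = ≡.subst Odd (≡.cong (λ m → 2 ℕ.+ m) (≡.sym (ℕ.+-suc n n))) (odd-1+n+n n)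

  -- Weighted binomials and multipliers that fix or negate them

  ∣-fixed-power : ∀ {d z} x m → d ∣ z * (1# - x) → d ∣ z * (1# - x ^ m)
  ∣-fixed-power {d} {z} x zero    _ = ∣ʳ-respʳ-≈
    (sym (trans (*-congˡ (-‿inverseʳ 1#)) (zeroʳ z))) (d ∣0)
  ∣-fixed-power {d} {z} x (suc m) p = ∣ʳ-respʳ-≈
    (solve 3 (λ z x y → z :* (:1 :- x) :+ x :* (z :* (:1 :- y)) := z :* (:1 :- x :* y)) refl z x (x ^ m))
    (∣-+ p (x∣ʳy⇒x∣ʳzy x (∣-fixed-power x m p)))

  -- An odd power of a multiplier that acts as -1 again acts as -1. Two exponents are removed at a
  -- time by 1 + x³y = (1 + x)(1 - x) + x²(1 + xy).
  ∣-negated-power : ∀ {d z} x k → d ∣ z * (1# + x) → d ∣ z * (1# + x ^ suc (dbl k))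
  ∣-negated-power         x zero    p = ∣ʳ-respʳ-≈ (*-congˡ (+-congˡ (sym (*-identityʳ x)))) p
  ∣-negated-power {d} {z} x (suc k) p = ∣ʳ-respʳ-≈
    (solve 3 (λ z x y → (z :* (:1 :+ x)) :* (:1 :- x) :+ (x :* x) :* (z :* (:1 :+ x :* y))
                        := z :* (:1 :+ x :* (x :* (x :* y)))) refl z x (x ^ dbl k))
    (∣-+ (∣-*ʳ (1# - x) p) (x∣ʳy⇒x∣ʳzy (x * x) (∣-negated-power x k p)))

  ^-dbl-suc-+ : ∀ k l → q ^ suc (dbl k ℕ.+ suc (dbl l)) ≈ q ^ suc (k ℕ.+ l) * q ^ suc (k ℕ.+ l)
  ^-dbl-suc-+ k l = begin
    q ^ suc (dbl k ℕ.+ suc (dbl l))            ≡⟨ ≡.cong (λ n → q ^ suc n) (ℕ.+-suc (dbl k) (dbl l)) ⟩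
    q ^ suc (suc (dbl k ℕ.+ dbl l))            ≡⟨ ≡.cong (λ n → q ^ suc (suc n)) (dbl-+ k l) ⟨
    q ^ dbl (suc (k ℕ.+ l))                    ≈⟨ ^-dbl (suc (k ℕ.+ l)) ⟩
    q ^ suc (k ℕ.+ l) * q ^ suc (k ℕ.+ l)      ∎

  weighted : (ℕ → ℕ → Carrier) → ℕ → ℕ → Carrier
  weighted c k l = c k l * (poch k * poch l)

  weighted-swap : ∀ c c′ → (∀ k l → c l k ≈ c′ k l) → ∀ k l → weighted c l k ≈ weighted c′ k l
  weighted-swap c c′ c≈c′ k l = *-cong (c≈c′ k l) (*-comm _ _)

  module Conclusion
    (halve   : ∀ n {x} → poch n ∣ x + x → poch n ∣ x)
    (unshift : ∀ n {x} → poch n ∣ q * x → poch n ∣ x)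
    where
    open Divisibility halve

    mutual
      -- For positive indices, write `u`, `v` for the last powers of q in the two weights. Modulo
      -- the new `poch`, absorption shows that multiplication by `u` and by `v` each fix the
      -- weighted coefficient `x`, while Pascal's rule shows that `u * v` negates it. So `x` is
      -- congruent to its negative.
      ee-divisible : ∀ k l → poch (k ℕ.+ l) ∣ weighted ee k l
      ee-divisible zero    l       = 1# , solve 1 (λ p → :1 :* p := :1 :* (:1 :* p)) refl (poch l)
      ee-divisible (suc k) zero    rewrite ℕ.+-identityʳ k =
        1# , solve 1 (λ p → :1 :* p := :1 :* (p :* :1)) refl (poch (suc k))
      ee-divisible (suc k) (suc l) = halve (suc n) (∣ʳ-respʳ-≈ 2x (∣-+ (∣-+ x[1-u] (x∣ʳy⇒x∣ʳzy u x[1-v])) x[1+uv]))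
        where
        n = k ℕ.+ suc l
        u = q ^ suc k
        v = q ^ suc l
        Q = q ^ suc n
        x = weighted ee (suc k) (suc l)
        oe-n : poch n ∣ weighted oe k (suc l)
        oe-n = oe-divisible k (suc l)
        eo-n : poch n ∣ weighted eo (suc k) l
        eo-n = ≡.subst (λ m → poch m ∣ weighted eo (suc k) l) (≡.sym (ℕ.+-suc k l)) (eo-divisible (suc k) l)
        Q≈uv : Q ≈ u * v
        Q≈uv = ^-homo-* q (suc k) (suc l)
        q^2n : q ^ suc (suc (dbl k) ℕ.+ suc (suc (dbl l))) ≈ Q * Q
        q^2n = trans (^-congʳ q (≡.sym (dbl-+ (suc k) (suc l)))) (^-dbl (suc n))
        q^2n′ : q ^ suc (suc (suc (dbl k)) ℕ.+ suc (dbl l)) ≈ Q * Q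
        q^2n′ = trans (^-congʳ q (≡.cong (λ m → 2 ℕ.+ m) (≡.sym (ℕ.+-suc (dbl k) (suc (dbl l)))))) q^2n
        -- Absorption brings the factor 1 - u²; its part 1 + u completes `poch k` to `poch (suc k)`,
        -- and 1 - u is left over.
        x[1-u] : poch (suc n) ∣ x * (1# - u)
        x[1-u] = ∣ʳ-respʳ-≈ eq (poch-gain² n oe-n)
          where
          eq : weighted oe k (suc l) * (1# - Q * Q) ≈ x * (1# - u)
          eq = begin
            (oe k (suc l) * (poch k * poch (suc l))) * (1# - Q * Q)
              ≈⟨ *-congˡ (+-congˡ (-‿cong q^2n)) ⟨
            (oe k (suc l) * (poch k * poch (suc l))) * (1# - Q′)
              ≈⟨ solve 3 (λ e p Q → (e :* p) :* (:1 :- Q) := ((:1 :- Q) :* e) :* p) refl _ _ Q′ ⟩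
            ((1# - Q′) * oe k (suc l)) * (poch k * poch (suc l))
              ≈⟨ *-congʳ (absorbˡ (suc (dbl k)) (dbl (suc l))) ⟨
            ((1# - q ^ dbl (suc k)) * ee (suc k) (suc l)) * (poch k * poch (suc l))
              ≈⟨ *-congʳ (*-congʳ (+-congˡ (-‿cong (^-dbl (suc k))))) ⟩
            ((1# - u * u) * ee (suc k) (suc l)) * (poch k * poch (suc l))
              ≈⟨ solve 4 (λ u e p r → ((:1 :- u :* u) :* e) :* (p :* r) := (e :* ((p :* (:1 :+ u)) :* r)) :* (:1 :- u))
                   refl u _ (poch k) (poch (suc l)) ⟩
            x * (1# - u)
              ∎
            where Q′ = q ^ suc (suc (dbl k) ℕ.+ suc (suc (dbl l)))
        x[1-v] : poch (suc n) ∣ x * (1# - v)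
        x[1-v] = ∣ʳ-respʳ-≈ eq (poch-gain² n eo-n)
          where
          eq : weighted eo (suc k) l * (1# - Q * Q) ≈ x * (1# - v)
          eq = begin
            (eo (suc k) l * (poch (suc k) * poch l)) * (1# - Q * Q)
              ≈⟨ *-congˡ (+-congˡ (-‿cong q^2n′)) ⟨
            (eo (suc k) l * (poch (suc k) * poch l)) * (1# - Q′)
              ≈⟨ solve 3 (λ e p Q → (e :* p) :* (:1 :- Q) := ((:1 :- Q) :* e) :* p) refl _ _ Q′ ⟩
            ((1# - Q′) * eo (suc k) l) * (poch (suc k) * poch l)
              ≈⟨ *-congʳ (absorbʳ (dbl (suc k)) (suc (dbl l))) ⟨
            ((1# - q ^ dbl (suc l)) * ee (suc k) (suc l)) * (poch (suc k) * poch l)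
              ≈⟨ *-congʳ (*-congʳ (+-congˡ (-‿cong (^-dbl (suc l))))) ⟩
            ((1# - v * v) * ee (suc k) (suc l)) * (poch (suc k) * poch l)
              ≈⟨ solve 4 (λ v e p r → ((:1 :- v :* v) :* e) :* (p :* r) := (e :* (p :* (r :* (:1 :+ v)))) :* (:1 :- v))
                   refl v _ (poch (suc k)) (poch l) ⟩
            x * (1# - v)
              ∎
            where Q′ = q ^ suc (suc (suc (dbl k)) ℕ.+ suc (dbl l))
        -- Pascal's rule gives only that `poch n` divides `x`; the multiplier `1# + Q` is itself the
        -- missing factor.
        x[1+uv] : poch (suc n) ∣ x * (1# + Q)
        x[1+uv] = poch-gain n (∣ʳ-respʳ-≈ eq
          (∣-+ (∣-*ʳ (1# + u) oe-n) (x∣ʳy⇒x∣ʳzy (q ^ dbl (suc k)) (∣-*ʳ (1# + v) eo-n))))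
          where
          eq : weighted oe k (suc l) * (1# + u) + q ^ dbl (suc k) * (weighted eo (suc k) l * (1# + v)) ≈ x
          eq = solve 7 (λ c d w p r u v →
              (c :* (p :* (r :* (:1 :+ v)))) :* (:1 :+ u) :+ w :* ((d :* ((p :* (:1 :+ u)) :* r)) :* (:1 :+ v))
              := (c :+ w :* d) :* ((p :* (:1 :+ u)) :* (r :* (:1 :+ v))))
            refl (oe k (suc l)) (eo (suc k) l) (q ^ dbl (suc k)) (poch k) (poch l) u v
        2x : (x * (1# - u) + u * (x * (1# - v))) + x * (1# + Q) ≈ x + x
        2x = trans (+-congˡ (*-congˡ (+-congˡ Q≈uv)))
          (solve 3 (λ x u v → (x :* (:1 :- u) :+ u :* (x :* (:1 :- v))) :+ x :* (:1 :+ u :* v) := x :+ x) refl x u v)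

      -- Pascal's rule lowers the left index of the `oo` term, and the additional factor in
      -- `oo-divisible` makes up for this.
      eo-divisible : ∀ k l → poch (k ℕ.+ l) ∣ weighted eo k l
      eo-divisible zero    l = 1# , solve 1 (λ p → :1 :* p := :1 :* (:1 :* p)) refl (poch l)
      eo-divisible (suc k) l = ∣ʳ-respʳ-≈ eq
        (∣-+ (x∣ʳy⇒x∣ʳzy Q (∣-*ʳ (1# + u) (oo-divisible k l))) (ee-divisible (suc k) l))
        where
        u = q ^ suc k
        Q = q ^ suc (dbl l)
        eq : Q * (weighted oo k l * (1# + u)) + weighted ee (suc k) l ≈ weighted eo (suc k) l
        eq = begin
          Q * (weighted oo k l * (1# + u)) + weighted ee (suc k) l
            ≈⟨ solve 6 (λ Q c d p u r → Q :* ((c :* (p :* r)) :* (:1 :+ u)) :+ d :* ((p :* (:1 :+ u)) :* r)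
                 := (Q :* c :+ d) :* ((p :* (:1 :+ u)) :* r)) refl Q (oo k l) (ee (suc k) l) (poch k) u (poch l) ⟩
          (Q * oo k l + ee (suc k) l) * (poch (suc k) * poch l)
            ≈⟨ *-congʳ (pascal′ (suc (dbl k)) (dbl l)) ⟨
          weighted eo (suc k) l
            ∎

      oe-divisible : ∀ k l → poch (k ℕ.+ l) ∣ weighted oe k l
      oe-divisible k l = ∣ʳ-respʳ-≈ (weighted-swap eo oe (λ k l → binom-sym (dbl l) (suc (dbl k))) k l)
        (≡.subst (λ m → poch m ∣ weighted eo l k) (ℕ.+-comm l k) (eo-divisible l k))

      -- Modulo poch (n + 1), where n = k + l, multiplying weighted oo k l by q^(2k+1) changes nothing and
      -- multiplying it by q^(n+1) changes the sign, so q^((n+1)(2k+1)) makes it congruent to its negative.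
      oo-divisible : ∀ k l → poch (suc (k ℕ.+ l)) ∣ weighted oo k l
      oo-divisible k l = halve (suc n) (∣ʳ-respʳ-≈ 2z
        (∣-+ (∣-fixed-power (q ^ a) (suc n) z[1-qᵃ]) (∣-negated-power Q k z[1+Q])))
        where
        n = k ℕ.+ l
        a = suc (dbl k)
        Q = q ^ suc n
        z = weighted oo k l
        z[1-qᵃ] : poch (suc n) ∣ z * (1# - q ^ a)
        z[1-qᵃ] = ∣ʳ-respʳ-≈ eq (poch-gain² n (eo-divisible k l))
          where
          eq : weighted eo k l * (1# - Q * Q) ≈ z * (1# - q ^ a)
          eq = begin
            (eo k l * (poch k * poch l)) * (1# - Q * Q)
              ≈⟨ *-congˡ (+-congˡ (-‿cong (^-dbl-suc-+ k l))) ⟨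
            (eo k l * (poch k * poch l)) * (1# - Q′)
              ≈⟨ solve 3 (λ e p Q → (e :* p) :* (:1 :- Q) := ((:1 :- Q) :* e) :* p) refl _ _ Q′ ⟩
            ((1# - Q′) * eo k l) * (poch k * poch l)
              ≈⟨ *-congʳ (absorbˡ (dbl k) (suc (dbl l))) ⟨
            ((1# - q ^ a) * oo k l) * (poch k * poch l)
              ≈⟨ solve 3 (λ u e p → ((:1 :- u) :* e) :* p := (e :* p) :* (:1 :- u)) refl (q ^ a) _ _ ⟩
            z * (1# - q ^ a)
              ∎
            where Q′ = q ^ suc (dbl k ℕ.+ suc (dbl l))
        z[1+Q] : poch (suc n) ∣ z * (1# + Q)
        z[1+Q] = poch-gain n (∣ʳ-respʳ-≈
          (solve 4 (λ c d w p → c :* p :+ w :* (d :* p) := (c :+ w :* d) :* p) refl (eo k l) (oe k l) (q ^ a) _)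
          (∣-+ (eo-divisible k l) (x∣ʳy⇒x∣ʳzy (q ^ a) (oe-divisible k l))))
        2z : z * (1# - (q ^ a) ^ suc n) + z * (1# + Q ^ a) ≈ z + z
        2z = trans (+-congʳ (*-congˡ (+-congˡ (-‿cong (trans (^-assocʳ q a (suc n))
               (trans (^-congʳ q (ℕ.*-comm a (suc n))) (sym (^-assocʳ q (suc n) a))))))))
          (solve 2 (λ z y → z :* (:1 :- y) :+ z :* (:1 :+ y) := z :+ z) refl z (Q ^ a))

    -- Divisibility of the products with `cos` and of the quotient series

    -- For positive index the product for ε = -1 starts with 1 - 1 = 0, and the one for ε = 1 starts
    -- with 2. Hence twice `evenSum (suc m)` is twice `poch (suc (dbl m))`, which contains all
    -- factors of `poch (suc m)`.
    evenSum-divisible : ∀ m → poch m ∣ evenSum m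
    evenSum-divisible zero    = _ , *-identityʳ _
    evenSum-divisible (suc m) = halve (suc m) (∣ʳ-respʳ-≈ eq (x∣ʳy⇒x∣ʳzy (1# + 1#) d))
      where
      n = suc (dbl m)
      d : poch (suc m) ∣ poch n
      d = ≡.subst (λ i → poch (suc m) ∣ poch i) (dbl-suc m) (poch-∣-+ m (suc m))
      eq : (1# + 1#) * poch n ≈ evenSum (suc m) + evenSum (suc m)
      eq = begin
        (1# + 1#) * poch n
          ≡⟨ ≡.cong (λ i → (1# + 1#) * poch i) (ℕ.+-identityʳ n) ⟨
        (1# + 1#) * poch (n ℕ.+ 0)
          ≈⟨ *-congˡ (poch-*-qsum n 0) ⟨
        (1# + 1#) * (1# * qsum 1# n 1)
          ≈⟨ solve 2 (λ x y → (:1 :+ :1) :* (:1 :* x) := (:1 :+ :1 :* :1) :* x :+ (y :- y)) refl (qsum 1# n 1) (qsum (- 1#) n 1) ⟩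
        (1# + 1# * 1#) * qsum 1# n 1 + (qsum (- 1#) n 1 - qsum (- 1#) n 1)
          ≈⟨ +-congˡ (solve 1 (λ y → y :- y := (:1 :+ (:- :1) :* :1) :* y) refl (qsum (- 1#) n 1)) ⟩
        (1# + 1# * q ^ 0) * qsum 1# n 1 + (1# + - 1# * q ^ 0) * qsum (- 1#) n 1
          ≈⟨ +-cong (q-binomial 1# n 0) (q-binomial (- 1#) n 0) ⟨
        qsum 1# (suc n) 0 + qsum (- 1#) (suc n) 0
          ≈⟨ evenSum-double (suc m) ⟩
        evenSum (suc m) + evenSum (suc m)
          ∎

    unshift-^ : ∀ n a {x} → poch n ∣ q ^ a * x → poch n ∣ x
    unshift-^ n zero    d = ∣ʳ-respʳ-≈ (*-identityˡ _) d
    unshift-^ n (suc a) d = unshift-^ n a (unshift n (∣ʳ-respʳ-≈ (*-assoc _ _ _) d))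

    unshift-gauss : ∀ n a k {x} → poch n ∣ gauss a k * x → poch n ∣ x
    unshift-gauss n a zero    d = ∣ʳ-respʳ-≈ (*-identityˡ _) d
    unshift-gauss n a (suc k) d =
      unshift-gauss n (suc a) k (unshift-^ n a (∣ʳ-respʳ-≈ (*-assoc _ _ _) d))

    cos⋆den-divisible : ∀ n → poch n ∣ (cos ⋆ den) n
    cos⋆den-divisible n = ∣ʳ-respʳ-≈ (sym (cos⋆den n)) (x∣ʳy⇒x∣ʳzy (± n) (evenSum-divisible n))

    cos⋆num-divisible : ∀ n → poch n ∣ (cos ⋆ num) n
    cos⋆num-divisible n = unshift-gauss n 1 n
      (∣ʳ-respʳ-≈ (cos⋆num n) (altee-divisible n 1 n (odd-1+n+n n)))

    weighted-product : ∀ k l {x y} → poch k ∣ x → poch l ∣ y → poch (k ℕ.+ l) ∣ ee k l * (x * y)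
    weighted-product k l (u , u≈x) (v , v≈y) = ∣ʳ-respʳ-≈
      (trans (solve 5 (λ u v e p r → (u :* v) :* (e :* (p :* r)) := e :* ((u :* p) :* (v :* r)))
               refl u v (ee k l) (poch k) (poch l))
             (*-congˡ (*-cong u≈x v≈y)))
      (x∣ʳy⇒x∣ʳzy (u * v) (ee-divisible k l))

    module _ (s : ℕ → Carrier) (den⋆s≈num : ∀ n → (den ⋆ s) n ≈ num n) where

      cos⋆den⋆s : ∀ n → ((cos ⋆ den) ⋆ s) n ≈ (cos ⋆ num) n
      cos⋆den⋆s n = trans (⋆-assoc cos den s n) (⋆-congˡ cos den⋆s≈num n)

      divisible : ∀ n → poch n ∣ s n
      divisible = <-rec (λ n → poch n ∣ s n) step
        where
        step : ∀ n → (∀ {m} → m ℕ.< n → poch m ∣ s m) → poch n ∣ s n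
        step zero    _   = _ , *-identityʳ _
        step (suc n) rec = ∣ʳ-respʳ-≈ eq (∣-+ (cos⋆num-divisible (suc n)) (∣-neg rest-divisible))
          where
          w = cos ⋆ den
          rest = Σ₊ n λ k l → ee (suc k) l * (w (suc k) * s l)
          rest-divisible : poch (suc n) ∣ rest
          rest-divisible = ∣-Σ₊ n λ k l k+l≡n →
            ≡.subst (λ m → poch m ∣ ee (suc k) l * (w (suc k) * s l)) (≡.cong suc k+l≡n)
              (weighted-product (suc k) l (cos⋆den-divisible (suc k))
                (rec (ℕ.s≤s (≡.subst (l ℕ.≤_) k+l≡n (ℕ.m≤n+m l k)))))
          eq : (cos ⋆ num) (suc n) - rest ≈ s (suc n)
          eq = begin
            (cos ⋆ num) (suc n) - rest
              ≈⟨ +-congʳ (cos⋆den⋆s (suc n)) ⟨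
            -- The products of ones are `ee 0 (suc n)` and `w 0` unfolded: `cos ⋆ den` has constant
            -- coefficient 1, so `s (suc n)` is isolated without division.
            (1# * ((1# * (1# * (1# * 1#))) * s (suc n)) + rest) - rest
              ≈⟨ solve 2 (λ x r → (:1 :* ((:1 :* (:1 :* (:1 :* :1))) :* x) :+ r) :- r := x) refl (s (suc n)) rest ⟩
            s (suc n)
              ∎

  -- From the recurrence for all indices to the even ones

  gauss-0-dbl : ∀ k → gauss 0 (dbl k) ≈ q ^ (k ℕ.* (2 ℕ.* k ℕ.∸ 1))
  gauss-0-dbl zero          = refl
  -- A case of its own, so that the induction hypothesis is used only at positive indices, where the
  -- truncated subtraction reduces.
  gauss-0-dbl (suc zero)    = trans (*-identityˡ _) (*-identityʳ _)
  gauss-0-dbl (suc (suc k)) = begin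
    1# * (q ^ 1 * gauss 2 (dbl (suc k)))
      ≈⟨ *-identityˡ _ ⟩
    q ^ 1 * gauss 2 (dbl (suc k))
      ≈⟨ *-congˡ (trans (gauss-2+ 0 (dbl (suc k))) (*-congˡ (gauss-0-dbl (suc k)))) ⟩
    q ^ 1 * (q ^ dbl (dbl (suc k)) * q ^ e)
      ≈⟨ *-congˡ (^-homo-* q (dbl (dbl (suc k))) e) ⟨
    q ^ 1 * q ^ (dbl (dbl (suc k)) ℕ.+ e)
      ≈⟨ ^-homo-* q 1 (dbl (dbl (suc k)) ℕ.+ e) ⟨
    q ^ (1 ℕ.+ (dbl (dbl (suc k)) ℕ.+ e))
      ≡⟨ ≡.cong (λ n → q ^ (1 ℕ.+ (n ℕ.+ e))) (≡.trans (dbl≡2* (dbl (suc k))) (≡.cong (2 ℕ.*_) (dbl≡2* (suc k)))) ⟩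
    q ^ (1 ℕ.+ (2 ℕ.* (2 ℕ.* suc k) ℕ.+ e))
      ≡⟨ ≡.cong (q ^_) (arith k) ⟩
    q ^ (suc (suc k) ℕ.* (2 ℕ.* suc (suc k) ℕ.∸ 1))
      ∎
    where
    e = suc k ℕ.* (2 ℕ.* suc k ℕ.∸ 1)
    arith : ∀ k → 1 ℕ.+ (2 ℕ.* (2 ℕ.* suc k) ℕ.+ suc k ℕ.* (k ℕ.+ suc (k ℕ.+ 0)))
                ≡ suc (suc k) ℕ.* (suc k ℕ.+ suc (suc k ℕ.+ 0))
    arith = ℕ-Solver.solve-∀

  module SaliéRecurrence
    (halve   : ∀ n {x} → poch n ∣ x + x → poch n ∣ x)
    (unshift : ∀ n {x} → poch n ∣ q * x → poch n ∣ x)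
    (S N D : ℕ → Carrier) (B : ℕ → ℕ → Carrier)
    (B≈binom : ∀ k l → B (k ℕ.+ l) k ≈ binom k l)
    (D-even : ∀ k → D (dbl k) ≈ ± k * q ^ (k ℕ.* (2 ℕ.* k ℕ.∸ 1)))
    (D-odd  : ∀ k → D (suc (dbl k)) ≈ 0#)
    (N-even : ∀ n → N (dbl n) ≈ num n)
    (S-rec  : ∀ m → Σ₊ m (λ k l → (B m k * D k) * S l) ≈ N m)
    where

    -- As `D` vanishes at odd indices, the recurrence at 2n involves `S` at even indices only and
    -- becomes a convolution of even series.
    den⋆S : ∀ n → (den ⋆ λ l → S (dbl l)) n ≈ num n
    den⋆S n = begin
      Σ₊ n (λ k l → ee k l * (den k * S (dbl l)))
        ≈⟨ Σ₊-cong n (λ k l → trans (sym (*-assoc _ _ _))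
             (*-congʳ (*-congˡ (trans (*-congˡ (gauss-0-dbl k)) (sym (D-even k)))))) ⟩
      Σ₊ n (λ k l → T (dbl k) (dbl l))
        ≈⟨ Σ₊-even n T (λ k l → trans (*-congʳ (trans (*-congˡ (D-odd k)) (zeroʳ _))) (zeroˡ _)) ⟨
      Σ₊ (dbl n) T
        ≈⟨ Σ₊-cong-on (dbl n) (λ k l k+l≡ → *-congʳ (*-congʳ
             (≡.subst (λ m → B m k ≈ binom k l) k+l≡ (B≈binom k l)))) ⟨
      Σ₊ (dbl n) (λ k l → (B (dbl n) k * D k) * S l)
        ≈⟨ trans (S-rec (dbl n)) (N-even n) ⟩
      num n
        ∎
      where
      T : ℕ → ℕ → Carrier
      T k l = (binom k l * D k) * S l

    poch-∣-S : ∀ n → poch n ∣ S (dbl n)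
    poch-∣-S = Conclusion.divisible halve unshift (λ l → S (dbl l)) den⋆S

-- The ring ℤ[q]

coeff-+P : ∀ p r i → coeff (p +P r) i ≡ coeff p i ℤ.+ coeff r i
coeff-+P []      r       i       = ≡.sym (ℤ.+-identityˡ _)
coeff-+P (a ∷ p) []      i       = ≡.sym (ℤ.+-identityʳ _)
coeff-+P (a ∷ p) (b ∷ r) zero    = ≡.refl
coeff-+P (a ∷ p) (b ∷ r) (suc i) = coeff-+P p r i

coeff-negP : ∀ p i → coeff (negP p) i ≡ ℤ.- coeff p i
coeff-negP []      i       = ≡.refl
coeff-negP (a ∷ p) zero    = ≡.refl
coeff-negP (a ∷ p) (suc i) = coeff-negP p i

coeff-scale : ∀ a p i → coeff (map (a ℤ.*_) p) i ≡ a ℤ.* coeff p i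
coeff-scale a []      i       = ≡.sym (ℤ.*-zeroʳ a)
coeff-scale a (b ∷ p) zero    = ≡.refl
coeff-scale a (b ∷ p) (suc i) = coeff-scale a p i

coeff-drop : ∀ p i → coeff (drop 1 p) i ≡ coeff p (suc i)
coeff-drop []      i = ≡.refl
coeff-drop (a ∷ p) i = ≡.refl

coeff-∷*P : ∀ a p r i → coeff ((a ∷ p) *P r) i ≡ a ℤ.* coeff r i ℤ.+ coeff (0ℤ ∷ (p *P r)) i
coeff-∷*P a p r i = ≡.trans (coeff-+P (map (a ℤ.*_) r) _ i) (≡.cong (ℤ._+ _) (coeff-scale a r i))

0∷-cong : ∀ {p r} → p ≈P r → (0ℤ ∷ p) ≈P (0ℤ ∷ r)
0∷-cong p≈r zero    = ≡.refl
0∷-cong p≈r (suc i) = p≈r i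

0∷-+P : ∀ p r i → coeff (0ℤ ∷ (p +P r)) i ≡ coeff (0ℤ ∷ p) i ℤ.+ coeff (0ℤ ∷ r) i
0∷-+P p r zero    = ≡.refl
0∷-+P p r (suc i) = coeff-+P p r i

*P-congˡ : ∀ p r s → r ≈P s → (p *P r) ≈P (p *P s)
*P-congˡ []      r s r≈s i = ≡.refl
*P-congˡ (a ∷ p) r s r≈s i = begin
  coeff ((a ∷ p) *P r) i                            ≡⟨ coeff-∷*P a p r i ⟩
  a ℤ.* coeff r i ℤ.+ coeff (0ℤ ∷ (p *P r)) i       ≡⟨ ≡.cong₂ (λ x y → a ℤ.* x ℤ.+ y) (r≈s i) (0∷-cong (*P-congˡ p r s r≈s) i) ⟩
  a ℤ.* coeff s i ℤ.+ coeff (0ℤ ∷ (p *P s)) i       ≡⟨ coeff-∷*P a p s i ⟨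
  coeff ((a ∷ p) *P s) i                            ∎
  where open ≡-Reasoning

*P-zeroʳ : ∀ p → (p *P []) ≈P []
*P-zeroʳ []      i       = ≡.refl
*P-zeroʳ (a ∷ p) zero    = ≡.refl
*P-zeroʳ (a ∷ p) (suc i) = *P-zeroʳ p i

-- Multiplication recurses on its left factor; commutativity needs the mirror image of that
-- recursion.
*P-∷ : ∀ p b r i → coeff (p *P (b ∷ r)) i ≡ b ℤ.* coeff p i ℤ.+ coeff (0ℤ ∷ (p *P r)) i
*P-∷ []      b r zero    = ≡.sym (≡.trans (ℤ.+-identityʳ _) (ℤ.*-zeroʳ b))
*P-∷ []      b r (suc i) = ≡.sym (≡.trans (ℤ.+-identityʳ _) (ℤ.*-zeroʳ b))
*P-∷ (a ∷ p) b r zero    = ≡.cong (ℤ._+ 0ℤ) (ℤ.*-comm a b)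
*P-∷ (a ∷ p) b r (suc i) = begin
  coeff ((a ∷ p) *P (b ∷ r)) (suc i)
    ≡⟨ coeff-∷*P a p (b ∷ r) (suc i) ⟩
  a ℤ.* coeff r i ℤ.+ coeff (p *P (b ∷ r)) i
    ≡⟨ ≡.cong (λ x → a ℤ.* coeff r i ℤ.+ x) (*P-∷ p b r i) ⟩
  a ℤ.* coeff r i ℤ.+ (b ℤ.* coeff p i ℤ.+ coeff (0ℤ ∷ (p *P r)) i)
    ≡⟨ swap (a ℤ.* coeff r i) (b ℤ.* coeff p i) _ ⟩
  b ℤ.* coeff p i ℤ.+ (a ℤ.* coeff r i ℤ.+ coeff (0ℤ ∷ (p *P r)) i)
    ≡⟨ ≡.cong (λ x → b ℤ.* coeff p i ℤ.+ x) (coeff-∷*P a p r i) ⟨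
  b ℤ.* coeff p i ℤ.+ coeff ((a ∷ p) *P r) i
    ∎
  where
  open ≡-Reasoning
  swap : ∀ x y z → x ℤ.+ (y ℤ.+ z) ≡ y ℤ.+ (x ℤ.+ z)
  swap = ℤ-Solver.solve-∀

*P-comm : ∀ p r → (p *P r) ≈P (r *P p)
*P-comm []      r i = ≡.sym (*P-zeroʳ r i)
*P-comm (a ∷ p) r i = begin
  coeff ((a ∷ p) *P r) i                        ≡⟨ coeff-∷*P a p r i ⟩
  a ℤ.* coeff r i ℤ.+ coeff (0ℤ ∷ (p *P r)) i   ≡⟨ ≡.cong (λ x → a ℤ.* coeff r i ℤ.+ x) (0∷-cong (*P-comm p r) i) ⟩
  a ℤ.* coeff r i ℤ.+ coeff (0ℤ ∷ (r *P p)) i   ≡⟨ *P-∷ r a p i ⟨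
  coeff (r *P (a ∷ p)) i                        ∎
  where open ≡-Reasoning

*P-distribˡ : ∀ p r s → (p *P (r +P s)) ≈P (p *P r +P p *P s)
*P-distribˡ []      r s i = ≡.refl
*P-distribˡ (a ∷ p) r s i = begin
  coeff ((a ∷ p) *P (r +P s)) i
    ≡⟨ coeff-∷*P a p (r +P s) i ⟩
  a ℤ.* coeff (r +P s) i ℤ.+ coeff (0ℤ ∷ (p *P (r +P s))) i
    ≡⟨ ≡.cong₂ (λ x y → a ℤ.* x ℤ.+ y) (coeff-+P r s i) (≡.trans (0∷-cong (*P-distribˡ p r s) i) (0∷-+P (p *P r) (p *P s) i)) ⟩
  a ℤ.* (coeff r i ℤ.+ coeff s i) ℤ.+ (coeff (0ℤ ∷ (p *P r)) i ℤ.+ coeff (0ℤ ∷ (p *P s)) i)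
    ≡⟨ expand a (coeff r i) (coeff s i) _ _ ⟩
  (a ℤ.* coeff r i ℤ.+ coeff (0ℤ ∷ (p *P r)) i) ℤ.+ (a ℤ.* coeff s i ℤ.+ coeff (0ℤ ∷ (p *P s)) i)
    ≡⟨ ≡.cong₂ ℤ._+_ (coeff-∷*P a p r i) (coeff-∷*P a p s i) ⟨
  coeff ((a ∷ p) *P r) i ℤ.+ coeff ((a ∷ p) *P s) i
    ≡⟨ coeff-+P ((a ∷ p) *P r) ((a ∷ p) *P s) i ⟨
  coeff ((a ∷ p) *P r +P (a ∷ p) *P s) i
    ∎
  where
  open ≡-Reasoning
  expand : ∀ a x y z w → a ℤ.* (x ℤ.+ y) ℤ.+ (z ℤ.+ w) ≡ (a ℤ.* x ℤ.+ z) ℤ.+ (a ℤ.* y ℤ.+ w)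
  expand = ℤ-Solver.solve-∀

+P-cong : ∀ {p p′ r r′} → p ≈P p′ → r ≈P r′ → (p +P r) ≈P (p′ +P r′)
+P-cong {p} {p′} {r} {r′} p≈ r≈ i =
  ≡.trans (coeff-+P p r i) (≡.trans (≡.cong₂ ℤ._+_ (p≈ i) (r≈ i)) (≡.sym (coeff-+P p′ r′ i)))

*P-congʳ : ∀ p r s → p ≈P r → (p *P s) ≈P (r *P s)
*P-congʳ p r s p≈r i = ≡.trans (*P-comm p s i) (≡.trans (*P-congˡ s p r p≈r i) (*P-comm s r i))

*P-distribʳ : ∀ s p r → ((p +P r) *P s) ≈P (p *P s +P r *P s)
*P-distribʳ s p r i = ≡.trans (*P-comm (p +P r) s i) (≡.trans (*P-distribˡ s p r i)
  (+P-cong {s *P p} {p *P s} {s *P r} {r *P s} (*P-comm s p) (*P-comm s r) i))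

scale-*P : ∀ a p r i → coeff (map (a ℤ.*_) p *P r) i ≡ a ℤ.* coeff (p *P r) i
scale-*P a []      r i = ≡.sym (ℤ.*-zeroʳ a)
scale-*P a (b ∷ p) r i = begin
  coeff (map (a ℤ.*_) (b ∷ p) *P r) i
    ≡⟨ coeff-∷*P (a ℤ.* b) (map (a ℤ.*_) p) r i ⟩
  a ℤ.* b ℤ.* coeff r i ℤ.+ coeff (0ℤ ∷ (map (a ℤ.*_) p *P r)) i
    ≡⟨ ≡.cong (λ x → a ℤ.* b ℤ.* coeff r i ℤ.+ x) (step i) ⟩
  a ℤ.* b ℤ.* coeff r i ℤ.+ a ℤ.* coeff (0ℤ ∷ (p *P r)) i
    ≡⟨ factor a b (coeff r i) _ ⟩
  a ℤ.* (b ℤ.* coeff r i ℤ.+ coeff (0ℤ ∷ (p *P r)) i)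
    ≡⟨ ≡.cong (a ℤ.*_) (coeff-∷*P b p r i) ⟨
  a ℤ.* coeff ((b ∷ p) *P r) i
    ∎
  where
  open ≡-Reasoning
  step : ∀ i → coeff (0ℤ ∷ (map (a ℤ.*_) p *P r)) i ≡ a ℤ.* coeff (0ℤ ∷ (p *P r)) i
  step zero    = ≡.sym (ℤ.*-zeroʳ a)
  step (suc i) = scale-*P a p r i
  factor : ∀ a b x y → a ℤ.* b ℤ.* x ℤ.+ a ℤ.* y ≡ a ℤ.* (b ℤ.* x ℤ.+ y)
  factor = ℤ-Solver.solve-∀

0∷-*P : ∀ p r → ((0ℤ ∷ p) *P r) ≈P (0ℤ ∷ (p *P r))
0∷-*P p r i = ≡.trans (coeff-∷*P 0ℤ p r i) (ℤ.+-identityˡ _)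

*P-assoc : ∀ p r s → ((p *P r) *P s) ≈P (p *P (r *P s))
*P-assoc []      r s i = ≡.refl
*P-assoc (a ∷ p) r s i = begin
  coeff (((a ∷ p) *P r) *P s) i
    ≡⟨ *P-distribʳ s (map (a ℤ.*_) r) (0ℤ ∷ (p *P r)) i ⟩
  coeff (map (a ℤ.*_) r *P s +P (0ℤ ∷ (p *P r)) *P s) i
    ≡⟨ coeff-+P (map (a ℤ.*_) r *P s) ((0ℤ ∷ (p *P r)) *P s) i ⟩
  coeff (map (a ℤ.*_) r *P s) i ℤ.+ coeff ((0ℤ ∷ (p *P r)) *P s) i
    ≡⟨ ≡.cong₂ ℤ._+_ (scale-*P a r s i) (≡.trans (0∷-*P (p *P r) s i) (0∷-cong (*P-assoc p r s) i)) ⟩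
  a ℤ.* coeff (r *P s) i ℤ.+ coeff (0ℤ ∷ (p *P (r *P s))) i
    ≡⟨ coeff-∷*P a p (r *P s) i ⟨
  coeff ((a ∷ p) *P (r *P s)) i
    ∎
  where open ≡-Reasoning

*P-identityˡ : ∀ p → (oneP *P p) ≈P p
*P-identityˡ p i = ≡.trans (coeff-∷*P 1ℤ [] p i) (≡.trans (≡.cong₂ ℤ._+_ (ℤ.*-identityˡ (coeff p i)) (0∷[] i)) (ℤ.+-identityʳ _))
  where
  0∷[] : ∀ i → coeff (0ℤ ∷ []) i ≡ 0ℤ
  0∷[] zero    = ≡.refl
  0∷[] (suc i) = ≡.refl

+P-assoc : ∀ p r s → ((p +P r) +P s) ≈P (p +P (r +P s))
+P-assoc p r s i = begin
  coeff ((p +P r) +P s) i                      ≡⟨ coeff-+P (p +P r) s i ⟩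
  coeff (p +P r) i ℤ.+ coeff s i               ≡⟨ ≡.cong (ℤ._+ coeff s i) (coeff-+P p r i) ⟩
  coeff p i ℤ.+ coeff r i ℤ.+ coeff s i        ≡⟨ ℤ.+-assoc (coeff p i) _ _ ⟩
  coeff p i ℤ.+ (coeff r i ℤ.+ coeff s i)      ≡⟨ ≡.cong (λ x → coeff p i ℤ.+ x) (coeff-+P r s i) ⟨
  coeff p i ℤ.+ coeff (r +P s) i               ≡⟨ coeff-+P p (r +P s) i ⟨
  coeff (p +P (r +P s)) i                      ∎
  where open ≡-Reasoning

+P-comm : ∀ p r → (p +P r) ≈P (r +P p)
+P-comm p r i = ≡.trans (coeff-+P p r i) (≡.trans (ℤ.+-comm (coeff p i) _) (≡.sym (coeff-+P r p i)))

+P-identityʳ : ∀ p → (p +P []) ≈P p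
+P-identityʳ p i = ≡.trans (coeff-+P p [] i) (ℤ.+-identityʳ _)

+P-inverseˡ : ∀ p → (negP p +P p) ≈P []
+P-inverseˡ p i = ≡.trans (coeff-+P (negP p) p i)
  (≡.trans (≡.cong (ℤ._+ coeff p i) (coeff-negP p i)) (ℤ.+-inverseˡ (coeff p i)))

negP-cong : ∀ {p r} → p ≈P r → negP p ≈P negP r
negP-cong {p} {r} p≈r i = ≡.trans (coeff-negP p i) (≡.trans (≡.cong ℤ.-_ (p≈r i)) (≡.sym (coeff-negP r i)))

polyRing : CommutativeRing 0ℓ 0ℓ
polyRing = record
  { Carrier = Poly ; _≈_ = _≈P_ ; _+_ = _+P_ ; _*_ = _*P_ ; -_ = negP ; 0# = [] ; 1# = oneP
  ; isCommutativeRing = record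
    { isRing = record
      { +-isAbelianGroup = record
        { isGroup = record
          { isMonoid = record
            { isSemigroup = record
              { isMagma = record
                { isEquivalence = record
                  { refl  = λ i → ≡.refl
                  ; sym   = λ p≈r i → ≡.sym (p≈r i)
                  ; trans = λ p≈r r≈s i → ≡.trans (p≈r i) (r≈s i)
                  }
                ; ∙-cong = λ {p} {p′} {r} {r′} → +P-cong {p} {p′} {r} {r′}
                }
              ; assoc = +P-assoc
              }
            ; identity = (λ p i → ≡.refl) , +P-identityʳ
            }
          ; inverse = +P-inverseˡ , λ p i → ≡.trans (+P-comm p (negP p) i) (+P-inverseˡ p i)
          ; ⁻¹-cong = λ {p} {r} → negP-cong {p} {r}
          }
        ; comm = +P-comm
        }
      ; *-cong = λ {p} {p′} {r} {r′} p≈ r≈ i → ≡.trans (*P-congʳ p p′ r p≈ i) (*P-congˡ p′ r r′ r≈ i)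
      ; *-assoc = *P-assoc
      ; *-identity = *P-identityˡ , λ p i → ≡.trans (*P-comm p oneP i) (*P-identityˡ p i)
      ; distrib = *P-distribˡ , *P-distribʳ
      }
    ; *-comm = *P-comm
    }
  }

constants : +-*-rawRing -Raw-AlmostCommutative⟶ fromCommutativeRing polyRing
constants = record
  { ⟦_⟧    = λ a → a ∷ []
  ; +-homo = λ a b i → ≡.refl
  ; *-homo = λ { a b zero → ≡.sym (ℤ.+-identityʳ _) ; a b (suc i) → ≡.refl }
  ; -‿homo = λ a i → ≡.refl
  ; 0-homo = λ { zero → ≡.refl ; (suc i) → ≡.refl }
  ; 1-homo = λ i → ≡.refl
  }

-- Division by polynomials with constant term 1

x+x≡0⇒x≡0 : ∀ x → x ℤ.+ x ≡ 0ℤ → x ≡ 0ℤ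
x+x≡0⇒x≡0 (ℤ.+ zero) _ = ≡.refl

*P-coeff-0 : ∀ p r → coeff (p *P r) 0 ≡ coeff p 0 ℤ.* coeff r 0
*P-coeff-0 []      r = ≡.refl
*P-coeff-0 (a ∷ p) r = ≡.trans (coeff-∷*P a p r 0) (ℤ.+-identityʳ _)


-- Dividing by a polynomial with constant term 1 from the lowest coefficient upwards, one sees that
-- the quotient of an even polynomial is even.
halve-quotient : ∀ p → coeff p 0 ≡ 1ℤ → ∀ s x → (s *P p) ≈P (x +P x) → ∃ λ t → (t *P p) ≈P x
halve-quotient p p₀≡1 []      x sp≈2x =
  [] , λ i → ≡.sym (x+x≡0⇒x≡0 _ (≡.sym (≡.trans (sp≈2x i) (coeff-+P x x i))))
halve-quotient p p₀≡1 (a ∷ s) x sp≈2x =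
  let t , tp≈y = halve-quotient p p₀≡1 s y sp≈2y in x₀ ∷ t , λ where
    zero    → ≡.trans (*P-coeff-0 (x₀ ∷ t) p) (≡.trans (≡.cong (x₀ ℤ.*_) p₀≡1) (ℤ.*-identityʳ x₀))
    (suc i) → ≡.trans (coeff-∷*P x₀ t p (suc i))
      (≡.trans (≡.cong (λ z → x₀ ℤ.* coeff p (suc i) ℤ.+ z) (≡.trans (tp≈y i) (coeff-y i)))
               (cancel (x₀ ℤ.* coeff p (suc i)) (coeff x (suc i))))
  where
  open ≡-Reasoning
  x₀ = coeff x 0
  -- This is (x - x₀ p)/q: as `p` has constant term 1, subtracting `x₀` times `p` clears the
  -- constant term of `x`.
  y  = drop 1 x -P map (x₀ ℤ.*_) (drop 1 p)
  cancel : ∀ u v → u ℤ.+ (v ℤ.- u) ≡ v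
  cancel = ℤ-Solver.solve-∀
  coeff-y : ∀ i → coeff y i ≡ coeff x (suc i) ℤ.- x₀ ℤ.* coeff p (suc i)
  coeff-y i = ≡.trans (coeff-+P (drop 1 x) _ i) (≡.cong₂ ℤ._+_ (coeff-drop x i)
    (≡.trans (coeff-negP (map (x₀ ℤ.*_) (drop 1 p)) i) (≡.cong ℤ.-_
      (≡.trans (coeff-scale x₀ (drop 1 p) i) (≡.cong (x₀ ℤ.*_) (coeff-drop p i))))))
  a≡2x₀ : a ≡ x₀ ℤ.+ x₀
  a≡2x₀ = begin
    a                        ≡⟨ ≡.trans (≡.cong (a ℤ.*_) p₀≡1) (ℤ.*-identityʳ a) ⟨
    a ℤ.* coeff p 0          ≡⟨ *P-coeff-0 (a ∷ s) p ⟨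
    coeff ((a ∷ s) *P p) 0   ≡⟨ ≡.trans (sp≈2x 0) (coeff-+P x x 0) ⟩
    x₀ ℤ.+ x₀                ∎
  isolate : ∀ u v w → w ≡ (u ℤ.+ u) ℤ.* v ℤ.+ w ℤ.- (u ℤ.+ u) ℤ.* v
  isolate = ℤ-Solver.solve-∀
  regroup : ∀ u v w → w ℤ.+ w ℤ.- (u ℤ.+ u) ℤ.* v ≡ (w ℤ.- u ℤ.* v) ℤ.+ (w ℤ.- u ℤ.* v)
  regroup = ℤ-Solver.solve-∀
  sp≈2y : (s *P p) ≈P (y +P y)
  sp≈2y i = begin
    coeff (s *P p) i
      ≡⟨ isolate x₀ pᵢ _ ⟩
    (x₀ ℤ.+ x₀) ℤ.* pᵢ ℤ.+ coeff (s *P p) i ℤ.- (x₀ ℤ.+ x₀) ℤ.* pᵢ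
      ≡⟨ ≡.cong (λ b → b ℤ.* pᵢ ℤ.+ coeff (s *P p) i ℤ.- (x₀ ℤ.+ x₀) ℤ.* pᵢ) a≡2x₀ ⟨
    a ℤ.* pᵢ ℤ.+ coeff (s *P p) i ℤ.- (x₀ ℤ.+ x₀) ℤ.* pᵢ
      ≡⟨ ≡.cong (λ b → b ℤ.- (x₀ ℤ.+ x₀) ℤ.* pᵢ) (≡.trans (≡.sym (coeff-∷*P a s p (suc i)))
           (≡.trans (sp≈2x (suc i)) (coeff-+P x x (suc i)))) ⟩
    coeff x (suc i) ℤ.+ coeff x (suc i) ℤ.- (x₀ ℤ.+ x₀) ℤ.* pᵢ
      ≡⟨ regroup x₀ pᵢ (coeff x (suc i)) ⟩
    (coeff x (suc i) ℤ.- x₀ ℤ.* pᵢ) ℤ.+ (coeff x (suc i) ℤ.- x₀ ℤ.* pᵢ)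
      ≡⟨ ≡.cong₂ ℤ._+_ (coeff-y i) (coeff-y i) ⟨
    coeff y i ℤ.+ coeff y i
      ≡⟨ coeff-+P y y i ⟨
    coeff (y +P y) i
      ∎
    where pᵢ = coeff p (suc i)

X : Poly
X = 0ℤ ∷ oneP

X-*P : ∀ p → (X *P p) ≈P (0ℤ ∷ p)
X-*P p i = ≡.trans (0∷-*P oneP p i) (0∷-cong (*P-identityˡ p) i)

-- Comparing constant terms shows that the quotient starts with 0; deleting this coefficient divides
-- it by q.
unshift-quotient : ∀ p → coeff p 0 ≡ 1ℤ → ∀ s x → (s *P p) ≈P (X *P x) → ∃ λ t → (t *P p) ≈P x
unshift-quotient p p₀≡1 []      x sp≈Xx = [] , λ i → ≡.trans (sp≈Xx (suc i)) (X-*P x (suc i))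
unshift-quotient p p₀≡1 (a ∷ s) x sp≈Xx = s , λ i → begin
  coeff (s *P p) i                                  ≡⟨ ℤ.+-identityˡ _ ⟨
  0ℤ ℤ.* coeff p (suc i) ℤ.+ coeff (s *P p) i       ≡⟨ ≡.cong (λ b → b ℤ.* coeff p (suc i) ℤ.+ coeff (s *P p) i) a≡0 ⟨
  a ℤ.* coeff p (suc i) ℤ.+ coeff (s *P p) i        ≡⟨ coeff-∷*P a s p (suc i) ⟨
  coeff ((a ∷ s) *P p) (suc i)                      ≡⟨ ≡.trans (sp≈Xx (suc i)) (X-*P x (suc i)) ⟩
  coeff x i                                         ∎
  where
  open ≡-Reasoning
  a≡0 : a ≡ 0ℤ
  a≡0 = begin
    a                        ≡⟨ ≡.trans (≡.cong (a ℤ.*_) p₀≡1) (ℤ.*-identityʳ a) ⟨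
    a ℤ.* coeff p 0          ≡⟨ *P-coeff-0 (a ∷ s) p ⟨
    coeff ((a ∷ s) *P p) 0   ≡⟨ ≡.trans (sp≈Xx 0) (X-*P x 0) ⟩
    0ℤ                       ∎

-- Identification with the given polynomials

open GaussianSums polyRing constants X
  using (Σ₊; Σ₊-cong; dbl; dbl≡2*; binom; binom-0; ±_; poch; num; module SaliéRecurrence)
open CommutativeRing polyRing using (semiring)
open import Algebra.Properties.Semiring.Exp semiring using (_^_)
open import Algebra.Properties.Semiring.Divisibility semiring using (_∣_; _,_)

half-dbl : ∀ n → half (dbl n) ≡ just n
half-dbl zero    = ≡.refl
half-dbl (suc n) rewrite half-dbl n = ≡.refl

half-suc-dbl : ∀ n → half (suc (dbl n)) ≡ nothing
half-suc-dbl zero    = ≡.refl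
half-suc-dbl (suc n) rewrite half-suc-dbl n = ≡.refl

^≈qPow : ∀ n → (X ^ n) ≈P qPow n
^≈qPow zero    i = ≡.refl
^≈qPow (suc n) i = ≡.trans (X-*P (X ^ n) i) (0∷-cong (^≈qPow n) i)

poch≈negqPoch : ∀ n → poch n ≈P negqPoch n
poch≈negqPoch zero    i = ≡.refl
poch≈negqPoch (suc n) i = ≡.trans
  (*P-congʳ (poch n) (negqPoch n) (oneP +P X ^ suc n) (poch≈negqPoch n) i)
  (*P-congˡ (negqPoch n) (oneP +P X ^ suc n) (oneP +P qPow (suc n))
    (+P-cong {oneP} {oneP} {X ^ suc n} {qPow (suc n)} (λ _ → ≡.refl) (^≈qPow (suc n))) i)

coeff-poch-0 : ∀ n → coeff (poch n) 0 ≡ 1ℤ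
coeff-poch-0 zero    = ≡.refl
coeff-poch-0 (suc n) = ≡.trans (*P-coeff-0 (poch n) (oneP +P X ^ suc n))
  (≡.cong₂ ℤ._*_ (coeff-poch-0 n)
    (≡.trans (coeff-+P oneP (X ^ suc n) 0) (≡.cong (λ z → 1ℤ ℤ.+ z) (X-*P (X ^ n) 0))))

halve : ∀ n {x} → poch n ∣ (x +P x) → poch n ∣ x
halve n {x} (s , eq) = let t , tp≈x = halve-quotient (poch n) (coeff-poch-0 n) s x eq in t , tp≈x

unshift : ∀ n {x} → poch n ∣ (X *P x) → poch n ∣ x
unshift n {x} (s , eq) = let t , tp≈x = unshift-quotient (poch n) (coeff-poch-0 n) s x eq in t , tp≈x

-- At the edge k = n the recursion of `qbin` steps outside Pascal's triangle, where `binom` has no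
-- entries; these extra terms have to vanish.
qbin-above : ∀ n d → qbin n (suc (n ℕ.+ d)) ≈P []
qbin-above zero    d i = ≡.refl
qbin-above (suc n) d i = begin
  coeff (qbin n (suc (n ℕ.+ d)) +P u *P qbin n (suc (suc (n ℕ.+ d)))) i
    ≡⟨ coeff-+P (qbin n (suc (n ℕ.+ d))) _ i ⟩
  coeff (qbin n (suc (n ℕ.+ d))) i ℤ.+ coeff (u *P qbin n (suc (suc (n ℕ.+ d)))) i
    ≡⟨ ≡.cong₂ ℤ._+_ (qbin-above n d i) (≡.trans (*P-congˡ u (qbin n (suc (suc (n ℕ.+ d)))) [] above′ i) (*P-zeroʳ u i)) ⟩
  0ℤ
    ∎
  where
  open ≡-Reasoning
  u = qPow (suc (suc (n ℕ.+ d)))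
  above′ : qbin n (suc (suc (n ℕ.+ d))) ≈P []
  above′ = ≡.subst (λ m → qbin n (suc m) ≈P []) (ℕ.+-suc n d) (qbin-above n (suc d))

qbin≈binom : ∀ k l → qbin (k ℕ.+ l) k ≈P binom k l
qbin≈binom zero    l       i = ≡.refl
qbin≈binom (suc k) zero    i = begin
  coeff (qbin (k ℕ.+ 0) k +P u *P qbin (k ℕ.+ 0) (suc k)) i
    ≡⟨ coeff-+P (qbin (k ℕ.+ 0) k) _ i ⟩
  coeff (qbin (k ℕ.+ 0) k) i ℤ.+ coeff (u *P qbin (k ℕ.+ 0) (suc k)) i
    ≡⟨ ≡.cong₂ ℤ._+_ (≡.trans (qbin≈binom k 0 i) (binom-0 k i))
         (≡.trans (*P-congˡ u (qbin (k ℕ.+ 0) (suc k)) [] above i) (*P-zeroʳ u i)) ⟩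
  coeff oneP i ℤ.+ 0ℤ
    ≡⟨ ℤ.+-identityʳ _ ⟩
  coeff oneP i
    ∎
  where
  open ≡-Reasoning
  u = qPow (suc k)
  above : qbin (k ℕ.+ 0) (suc k) ≈P []
  above = ≡.subst (λ m → qbin m (suc k) ≈P []) (≡.sym (ℕ.+-identityʳ k))
    (≡.subst (λ m → qbin k (suc m) ≈P []) (ℕ.+-identityʳ k) (qbin-above k 0))
qbin≈binom (suc k) (suc l) =
  +P-cong {qbin (k ℕ.+ suc l) k} {binom k (suc l)} (qbin≈binom k (suc l)) λ i →
    ≡.trans (*P-congˡ (qPow (suc k)) (qbin (k ℕ.+ suc l) (suc k)) (binom (suc k) l)
              (≡.subst (λ m → qbin m (suc k) ≈P binom (suc k) l) (≡.sym (ℕ.+-suc k l)) (qbin≈binom (suc k) l)) i)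
            (*P-congʳ (qPow (suc k)) (X ^ suc k) (binom (suc k) l) (λ j → ≡.sym (^≈qPow (suc k) j)) i)

sgn≈± : ∀ k → (sgn k ∷ []) ≈P (± k)
sgn≈± zero    i = ≡.refl
sgn≈± (suc k) i = begin
  coeff ((ℤ.- sgn k) ∷ []) i          ≡⟨ ≡.cong (λ a → coeff (a ∷ []) i) (ℤ.-1*i≡-i (sgn k)) ⟨
  coeff ((ℤ.-1ℤ ℤ.* sgn k) ∷ []) i    ≡⟨ *-homo ℤ.-1ℤ (sgn k) i ⟩
  coeff (negP oneP *P (sgn k ∷ [])) i ≡⟨ *P-congˡ (negP oneP) (sgn k ∷ []) (± k) (sgn≈± k) i ⟩
  coeff (± suc k) i                   ∎
  where
  open ≡-Reasoning
  open _-Raw-AlmostCommutative⟶_ constants using (*-homo)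

denC-even : ∀ k → denC (dbl k) ≈P ((± k) *P X ^ (k ℕ.* (2 ℕ.* k ℕ.∸ 1)))
denC-even k i rewrite half-dbl k = ≡.trans
  (*P-congʳ (sgn k ∷ []) (± k) (qPow e) (sgn≈± k) i)
  (*P-congˡ (± k) (qPow e) (X ^ e) (λ j → ≡.sym (^≈qPow e j)) i)
  where e = k ℕ.* (2 ℕ.* k ℕ.∸ 1)

denC-odd : ∀ k → denC (suc (dbl k)) ≈P []
denC-odd k i rewrite half-suc-dbl k = ≡.refl

numC-even : ∀ n → numC (dbl n) ≈P num n
numC-even n i rewrite half-dbl n = ≡.sym (^≈qPow (n ℕ.* (n ℕ.∸ 1)) i)

-- The local function of salieTable is not in scope here; the metavariable standing for it is solved
-- by the proof of salieTable-suc.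
mutual
  convolution : ℕ → ℕ → List Poly → Poly
  convolution = _

  salieTable-suc : ∀ m → salieTable (suc m) ≡ (numC (suc m) -P convolution m 0 (salieTable m)) ∷ salieTable m
  salieTable-suc m with 0 | salieTable m
  ... | i | t = ≡.refl

-- The offset `i` and the length `t` vary independently of `m`, because the recursion raises the one
-- while shortening the other. The recurrence uses the case i = 0, t = m.
convolution-salieTable : ∀ m i t →
  convolution m i (salieTable t) ≈P Σ₊ t λ k l → (qbin (suc m) (suc (i ℕ.+ k)) *P denC (suc (i ℕ.+ k))) *P salie l
convolution-salieTable m i zero    rewrite ℕ.+-identityʳ i = +P-identityʳ ((qbin (suc m) (suc i) *P denC (suc i)) *P oneP)
convolution-salieTable m i (suc t) j = begin
  coeff (T i *P salie (suc t) +P convolution m (suc i) (salieTable t)) j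
    ≡⟨ coeff-+P (T i *P salie (suc t)) _ j ⟩
  coeff (T i *P salie (suc t)) j ℤ.+ coeff (convolution m (suc i) (salieTable t)) j
    ≡⟨ ≡.cong₂ ℤ._+_ (≡.cong (λ n → coeff (T n *P salie (suc t)) j) (≡.sym (ℕ.+-identityʳ i)))
         (≡.trans (convolution-salieTable m (suc i) t j) (Σ₊-cong t reindex j)) ⟩
  coeff (F 0 (suc t)) j ℤ.+ coeff (Σ₊ t λ k l → F (suc k) l) j
    ≡⟨ coeff-+P (F 0 (suc t)) _ j ⟨
  coeff (Σ₊ (suc t) F) j
    ∎
  where
  open ≡-Reasoning
  T : ℕ → Poly
  T n = qbin (suc m) (suc n) *P denC (suc n)
  F : ℕ → ℕ → Poly
  F k l = T (i ℕ.+ k) *P salie l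
  reindex : ∀ k l → (T (suc i ℕ.+ k) *P salie l) ≈P F (suc k) l
  reindex k l j = ≡.cong (λ n → coeff (T n *P salie l) j) (≡.sym (ℕ.+-suc i k))

salie-recurrence : ∀ m → Σ₊ m (λ k l → (qbin m k *P denC k) *P salie l) ≈P numC m
salie-recurrence zero    i = *P-identityˡ oneP i
salie-recurrence (suc m) i = begin
  coeff ((oneP *P denC 0) *P salie (suc m) +P rest) i
    ≡⟨ coeff-+P ((oneP *P denC 0) *P salie (suc m)) rest i ⟩
  coeff ((oneP *P denC 0) *P salie (suc m)) i ℤ.+ coeff rest i
    ≡⟨ ≡.cong₂ ℤ._+_ (*P-identityˡ (salie (suc m)) i) (≡.sym (convolution-salieTable m 0 m i)) ⟩
  coeff (numC (suc m) -P c) i ℤ.+ coeff c i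
    ≡⟨ ≡.cong (ℤ._+ coeff c i) (≡.trans (coeff-+P (numC (suc m)) (negP c) i)
         (≡.cong (λ z → coeff (numC (suc m)) i ℤ.+ z) (coeff-negP c i))) ⟩
  coeff (numC (suc m)) i ℤ.- coeff c i ℤ.+ coeff c i
    ≡⟨ cancel (coeff (numC (suc m)) i) (coeff c i) ⟩
  coeff (numC (suc m)) i
    ∎
  where
  open ≡-Reasoning
  c = convolution m 0 (salieTable m)
  rest = Σ₊ m λ k l → (qbin (suc m) (suc k) *P denC (suc k)) *P salie l
  cancel : ∀ x y → x ℤ.- y ℤ.+ y ≡ x
  cancel = ℤ-Solver.solve-∀

open import Data.Nat using (_*_)

theorem1p2 : (n : ℕ) → negqPoch n ∣P salie (2 * n)
theorem1p2 n =
  let s , s*poch≈salie = poch-∣-S n in s , λ i → begin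
  coeff (negqPoch n *P s) i   ≡⟨ *P-congʳ (poch n) (negqPoch n) s (poch≈negqPoch n) i ⟨
  coeff (poch n *P s) i       ≡⟨ *P-comm (poch n) s i ⟩
  coeff (s *P poch n) i       ≡⟨ s*poch≈salie i ⟩
  coeff (salie (dbl n)) i     ≡⟨ ≡.cong (λ m → coeff (salie m) i) (dbl≡2* n) ⟩
  coeff (salie (2 * n)) i     ∎
  where
  open ≡-Reasoning
  open SaliéRecurrence halve unshift salie numC denC qbin qbin≈binom denC-even denC-odd numC-even salie-recurrence
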